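{- The class of exact graphs strictly contains the class of compact graphs. More precisely: 1. If $G$ is a compact graph, then $G$ is also exact. 2. Let $G_1,\dots,G_m$ be $k$-regular connected compact graphs, and let $G=\bigsqcup_{i=1}^mG_i$ be their disjoint union. Then $G$ is always exact, but $G$ may not be compact. Indeed, $G$ is compact if and only if $G_i\cong G_j$ for all $1\le i,j\le m$.
   Context: Graphs are finite, simple and undirected. For a graph $G$ on $\{1,\dots,n\}$ with adjacency matrix $A_G$, let $$P_G=\Big\{P\in\mathbb{R}^{n\times n}: PA_G=A_GP,\ \sum_{i}P_{i,j}=1\ \forall j,\ \sum_{j}P_{i,j}=1\ \forall i,\ P_{i,j}\ge0\ \forall i,j\Big\},$$ and let $IP_G=\mathrm{conv}(P_G\cap\mathbb{Z}^{n\times n})$ be its integer hull. $G$ is compact if $P_G=IP_G$. Let $I_G\subseteq\mathbb{R}[P_{i,j}:1\le i,j\le n]$ be the ideal generated by the entries of $PA_G-A_GP$, the polynomials $\sum_iP_{i,j}-1$ ($1\le j\le n$), $\sum_jP_{i,j}-1$ ($1\le i\le n$), and $P_{i,j}^2-P_{i,j}$ ($1\le i,j\le n$); its real zero set $V_{\mathbb{R}}(I_G)$ is the set of permutation matrices of automorphisms of $G$. For an ideal $I\subseteq\mathbb{R}[x_1,\dots,x_N]$, a polynomial $f$ is $k$-sos mod $I$ if there are polynomials $h_1,\dots,h_r$ of degree at most $k$ with $f-\sum_ih_i^2\in I$. The $k$-th theta body is $TH_k(I)=\{x\in\mathbb{R}^N: f(x)\ge0\text{ for every polynomial } f \text{ of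 degree at most } 1 \text{ that is }k\text{ -sos mod }I\}$. $I$ (or $V_{\mathbb{R}}(I)$) is $k$-exact if $\overline{\mathrm{conv}(V_{\mathbb{R}}(I))}=TH_k(I)$. A graph $G$ is exact if $I_G$ is $1$-exact. -}

module Defs where

open import Level using (0ℓ) renaming (suc to ℓsuc)
open import Algebra.Bundles using (CommutativeRing)
import Algebra.Definitions.RawMonoid as RawMonoidOps
open import Data.Bool.Base using (Bool; true; false; if_then_else_)
open import Data.Fin.Base using (Fin; zero; suc; splitAt)
open import Data.Fin.Subset using (Subset; ∣_∣)
open import Data.Integer.Base using (ℤ; +_; -[1+_])
open import Data.List.Base using (List; length; foldr)
open import Data.List.Relation.Unary.All using (All)
open import Data.Nat.Base as ℕ using (ℕ; zero; suc; NonZero; +-0-rawMonoid)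
open import Data.Product.Base using (∃; ∃-syntax; Σ-syntax; _×_; _,_)
open import Data.Sum.Base using (_⊎_; inj₁; inj₂)
open import Data.Vec.Base using (tabulate)
open import Function.Base using (_∘_)
open import Function.Bundles using (_↔_; Inverse)
open import Relation.Binary.Core using (Rel)
open import Relation.Binary.Structures using (IsDecTotalOrder; IsEquivalence)
import Relation.Binary.Construct.NonStrictToStrict as NonStrictToStrict
open import Relation.Binary.Construct.Closure.ReflexiveTransitive using (Star)
open import Relation.Binary.PropositionalEquality.Core using (_≡_; refl)
open import Relation.Nullary.Negation.Core using (¬_)
open import Relation.Unary using (Pred; _≐_; _∩_; _∈_)

-- The real numbers, axiomatised as a Dedekind-complete ordered field.
-- Classically this determines ℝ up to unique isomorphism.  As in the
-- classical theory, the order is decidable.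

record RealNumbers : Set (ℓsuc 0ℓ) where
  infix 4 _≤_
  field
    commutativeRing : CommutativeRing 0ℓ 0ℓ

  open CommutativeRing commutativeRing public

  field
    _≤_             : Rel Carrier 0ℓ
    isDecTotalOrder : IsDecTotalOrder _≈_ _≤_
    0≉1             : ¬ (0# ≈ 1#)
    inverse         : ∀ x → ¬ (x ≈ 0#) → ∃[ y ] (x * y ≈ 1#)
    +-monoʳ-≤       : ∀ x {y z} → y ≤ z → x + y ≤ x + z
    *-nonNegative   : ∀ {x y} → 0# ≤ x → 0# ≤ y → 0# ≤ x * y

  open NonStrictToStrict _≈_ _≤_ public using (_<_)

  UpperBound : Pred Carrier 0ℓ → Pred Carrier 0ℓ
  UpperBound S u = ∀ {x} → x ∈ S → x ≤ u

  field
    supremum : (S : Pred Carrier 0ℓ) → ∃ S → ∃ (UpperBound S) →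
               ∃[ s ] (UpperBound S s × (∀ {u} → UpperBound S u → s ≤ u))

record Graph (n : ℕ) : Set where
  field
    adj     : Fin n → Fin n → Bool
    adj-sym : ∀ u v → adj u v ≡ adj v u
    no-loop : ∀ u → adj u u ≡ false

open Graph public

Adjacent : ∀ {n} → Graph n → Rel (Fin n) 0ℓ
Adjacent G u v = adj G u v ≡ true

neighbours : ∀ {n} → Graph n → Fin n → Subset n
neighbours G u = tabulate (adj G u)

Regular : ∀ {n} → ℕ → Graph n → Set
Regular k G = ∀ u → ∣ neighbours G u ∣ ≡ k

-- The graph without vertices is not considered connected.
Connected : ∀ {n} → Graph n → Set
Connected {n} G = NonZero n × (∀ u v → Star (Adjacent G) u v)

infix 4 _≅_
_≅_ : ∀ {m n} → Graph m → Graph n → Set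
_≅_ {m} {n} G H =
  ∃ λ (φ : Fin m ↔ Fin n) →
    ∀ u v → adj H (Inverse.to φ u) (Inverse.to φ v) ≡ adj G u v

emptyGraph : Graph 0
emptyGraph .adj ()
emptyGraph .adj-sym ()
emptyGraph .no-loop ()

-- Vertices 0 … m-1 carry G, vertices m … m+n-1 carry H.
infixr 6 _⊔ᴳ_
_⊔ᴳ_ : ∀ {m n} → Graph m → Graph n → Graph (m ℕ.+ n)
_⊔ᴳ_ {m} {n} G H = record
  { adj     = λ u v → E (splitAt m u) (splitAt m v)
  ; adj-sym = λ u v → E-sym (splitAt m u) (splitAt m v)
  ; no-loop = λ u → E-loop (splitAt m u)
  }
  where
  E : Fin m ⊎ Fin n → Fin m ⊎ Fin n → Bool
  E (inj₁ u) (inj₁ v) = adj G u v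
  E (inj₂ u) (inj₂ v) = adj H u v
  E (inj₁ _) (inj₂ _) = false
  E (inj₂ _) (inj₁ _) = false

  E-sym : ∀ x y → E x y ≡ E y x
  E-sym (inj₁ u) (inj₁ v) = adj-sym G u v
  E-sym (inj₂ u) (inj₂ v) = adj-sym H u v
  E-sym (inj₁ _) (inj₂ _) = refl
  E-sym (inj₂ _) (inj₁ _) = refl

  E-loop : ∀ x → E x x ≡ false
  E-loop (inj₁ u) = no-loop G u
  E-loop (inj₂ u) = no-loop H u

order : ∀ {m} → (Fin m → ℕ) → ℕ
order = RawMonoidOps.sum +-0-rawMonoid

⨆ : ∀ {m} {n : Fin m → ℕ} → (∀ i → Graph (n i)) → Graph (order n)
⨆ {zero}  G = emptyGraph
⨆ {suc m} G = G zero ⊔ᴳ ⨆ (G ∘ suc)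

Matrix : Set → ℕ → Set
Matrix A n = Fin n × Fin n → A

module MatrixOver (R : CommutativeRing 0ℓ 0ℓ) where
  open CommutativeRing R
  open RawMonoidOps +-rawMonoid using (sum)

  infixl 7 _*ᴹ_
  _*ᴹ_ : ∀ {n} → Matrix Carrier n → Matrix Carrier n → Matrix Carrier n
  (M *ᴹ N) (i , j) = sum λ k → M (i , k) * N (k , j)

  adjacency : ∀ {n} → Graph n → Matrix Carrier n
  adjacency G (i , j) = if adj G i j then 1# else 0#

  rowSum columnSum : ∀ {n} → Matrix Carrier n → Fin n → Carrier
  rowSum    M i = sum λ j → M (i , j)
  columnSum M j = sum λ i → M (i , j)

-- The polynomial ring R[X] in the variables X, as the free commutative
-- R-algebra on X: terms modulo the congruence _≋_ generated by the
-- commutative ring laws and by `con` being a ring homomorphism.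

module Polynomials (R : CommutativeRing 0ℓ 0ℓ) (X : Set) where
  private module R = CommutativeRing R
  open R using (Carrier)

  infixl 6 _⊕_
  infixl 7 _⊗_
  infix  8 ⊝_
  infix  4 _≋_

  data Poly : Set where
    con     : Carrier → Poly
    var     : X → Poly
    _⊕_ _⊗_ : Poly → Poly → Poly
    ⊝_      : Poly → Poly

  data _≋_ : Rel Poly 0ℓ where
    ≋-refl  : ∀ {p} → p ≋ p
    ≋-sym   : ∀ {p q} → p ≋ q → q ≋ p
    ≋-trans : ∀ {p q r} → p ≋ q → q ≋ r → p ≋ r

    ⊕-cong : ∀ {p p′ q q′} → p ≋ p′ → q ≋ q′ → p ⊕ q ≋ p′ ⊕ q′
    ⊗-cong : ∀ {p p′ q q′} → p ≋ p′ → q ≋ q′ → p ⊗ q ≋ p′ ⊗ q′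
    ⊝-cong : ∀ {p p′} → p ≋ p′ → ⊝ p ≋ ⊝ p′

    ⊕-assoc     : ∀ p q r → (p ⊕ q) ⊕ r ≋ p ⊕ (q ⊕ r)
    ⊕-comm      : ∀ p q → p ⊕ q ≋ q ⊕ p
    ⊕-identityˡ : ∀ p → con R.0# ⊕ p ≋ p
    ⊝-inverseˡ  : ∀ p → ⊝ p ⊕ p ≋ con R.0#
    ⊗-assoc     : ∀ p q r → (p ⊗ q) ⊗ r ≋ p ⊗ (q ⊗ r)
    ⊗-comm      : ∀ p q → p ⊗ q ≋ q ⊗ p
    ⊗-identityˡ : ∀ p → con R.1# ⊗ p ≋ p
    ⊗-distribˡ  : ∀ p q r → p ⊗ (q ⊕ r) ≋ (p ⊗ q) ⊕ (p ⊗ r)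

    con-cong : ∀ {a b} → a R.≈ b → con a ≋ con b
    con-+    : ∀ a b → con (a R.+ b) ≋ con a ⊕ con b
    con-*    : ∀ a b → con (a R.* b) ≋ con a ⊗ con b

  polyRing : CommutativeRing 0ℓ 0ℓ
  polyRing = record
    { Carrier = Poly ; _≈_ = _≋_
    ; _+_ = _⊕_ ; _*_ = _⊗_ ; -_ = ⊝_ ; 0# = con R.0# ; 1# = con R.1#
    ; isCommutativeRing = record
      { isRing = record
        { +-isAbelianGroup = record
          { isGroup = record
            { isMonoid = record
              { isSemigroup = record
                { isMagma = record
                  { isEquivalence = ≋-isEquivalence ; ∙-cong = ⊕-cong }
                ; assoc = ⊕-assoc }
              ; identity = ⊕-identityˡ
                , λ p → ≋-trans (⊕-comm p _) (⊕-identityˡ p) }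
            ; inverse = ⊝-inverseˡ
              , λ p → ≋-trans (⊕-comm p _) (⊝-inverseˡ p)
            ; ⁻¹-cong = ⊝-cong }
          ; comm = ⊕-comm }
        ; *-cong = ⊗-cong
        ; *-assoc = ⊗-assoc
        ; *-identity = ⊗-identityˡ
          , λ p → ≋-trans (⊗-comm p _) (⊗-identityˡ p)
        ; distrib = ⊗-distribˡ
          , λ p q r → ≋-trans (⊗-comm (q ⊕ r) p)
              (≋-trans (⊗-distribˡ p q r) (⊕-cong (⊗-comm p q) (⊗-comm p r)))
        }
      ; *-comm = ⊗-comm
      }
    }
    where
    ≋-isEquivalence : IsEquivalence _≋_
    ≋-isEquivalence = record { refl = ≋-refl ; sym = ≋-sym ; trans = ≋-trans }

  eval : (X → Carrier) → Poly → Carrier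
  eval x (con c) = c
  eval x (var i) = x i
  eval x (p ⊕ q) = eval x p R.+ eval x q
  eval x (p ⊗ q) = eval x p R.* eval x q
  eval x (⊝ p)   = R.- eval x p

  -- A term c · x₁ ⋯ x_l is stored as (c , x₁ ∷ ⋯ ∷ x_l ∷ []).
  Term : Set
  Term = Carrier × List X

  term : Term → Poly
  term (c , xs) = con c ⊗ foldr (λ x p → var x ⊗ p) (con R.1#) xs

  -- p is a linear combination of monomials of degree at most d.
  DegreeAtMost : ℕ → Pred Poly 0ℓ
  DegreeAtMost d p = ∃[ ts ]
    ( All (λ { (_ , xs) → length xs ℕ.≤ d }) ts
    × p ≋ foldr (λ t q → term t ⊕ q) (con R.0#) ts )

  data Ideal⟨_⟩ (S : Pred Poly 0ℓ) : Pred Poly 0ℓ where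
    generator : ∀ {p} → S p → Ideal⟨ S ⟩ p
    zero-mem  : Ideal⟨ S ⟩ (con R.0#)
    add-mem   : ∀ {p q} → Ideal⟨ S ⟩ p → Ideal⟨ S ⟩ q → Ideal⟨ S ⟩ (p ⊕ q)
    mul-mem   : ∀ p {q} → Ideal⟨ S ⟩ q → Ideal⟨ S ⟩ (p ⊗ q)
    resp-mem  : ∀ {p q} → p ≋ q → Ideal⟨ S ⟩ p → Ideal⟨ S ⟩ q

module Over (ℝ : RealNumbers) where
  open RealNumbers ℝ
  open RawMonoidOps +-rawMonoid using (sum) renaming (_×_ to _·_)

  -- ℝ^X is X → Carrier; X is only ever used at finite types.

  conv : ∀ {X} → Pred (X → Carrier) 0ℓ → Pred (X → Carrier) 0ℓ
  conv {X} S x = ∃[ r ] Σ[ w ∈ (Fin r → Carrier) ] Σ[ p ∈ (Fin r → X → Carrier) ]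
    ( (∀ i → 0# ≤ w i) × sum w ≈ 1#
    × (∀ i → p i ∈ S)
    × (∀ a → x a ≈ sum λ i → w i * p i a) )

  -- Euclidean closure, via the (equivalent) maximum norm on ℝ^X, X finite.
  closure : ∀ {X} → Pred (X → Carrier) 0ℓ → Pred (X → Carrier) 0ℓ
  closure S x = ∀ ε → 0# < ε →
    ∃[ y ] (y ∈ S × (∀ a → x a - y a < ε × y a - x a < ε))

  fromℤ : ℤ → Carrier
  fromℤ (+ n)    = n · 1#
  fromℤ -[1+ n ] = - (suc n · 1#)

  Integral : ∀ {X} → Pred (X → Carrier) 0ℓ
  Integral x = ∀ a → ∃[ z ] (x a ≈ fromℤ z)

  module _ {X : Set} where
    open Polynomials commutativeRing X
    open CommutativeRing polyRing using () renaming (_-_ to _⊖_)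
    open RawMonoidOps (CommutativeRing.+-rawMonoid polyRing)
      using () renaming (sum to sumₚ)

    zeroSet : Pred Poly 0ℓ → Pred (X → Carrier) 0ℓ
    zeroSet I x = ∀ {f} → f ∈ I → eval x f ≈ 0#

    SosMod : ℕ → Pred Poly 0ℓ → Pred Poly 0ℓ
    SosMod k I f = ∃[ r ] Σ[ h ∈ (Fin r → Poly) ]
      ( (∀ i → h i ∈ DegreeAtMost k)
      × (f ⊖ sumₚ (λ i → h i ⊗ h i)) ∈ I )

    TH : ℕ → Pred Poly 0ℓ → Pred (X → Carrier) 0ℓ
    TH k I x = ∀ f → f ∈ DegreeAtMost 1 → f ∈ SosMod k I → 0# ≤ eval x f

    ExactIdeal : ℕ → Pred Poly 0ℓ → Set
    ExactIdeal k I = closure (conv (zeroSet I)) ≐ TH k I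

  module _ {n : ℕ} (G : Graph n) where

    P-polytope : Pred (Matrix Carrier n) 0ℓ
    P-polytope P =
        (∀ a → (P *ᴹ adjacency G) a ≈ (adjacency G *ᴹ P) a)
      × (∀ j → columnSum P j ≈ 1#)
      × (∀ i → rowSum P i ≈ 1#)
      × (∀ a → 0# ≤ P a)
      where open MatrixOver commutativeRing

    IP-polytope : Pred (Matrix Carrier n) 0ℓ
    IP-polytope = conv (P-polytope ∩ Integral)

    Compact : Set
    Compact = P-polytope ≐ IP-polytope

    open Polynomials commutativeRing (Fin n × Fin n)
    open CommutativeRing polyRing using () renaming (_-_ to _⊖_; 1# to 1ₚ)
    open MatrixOver polyRing

    indeterminate : Matrix Poly n
    indeterminate = var

    data Generator : Pred Poly 0ℓ where
      commute : ∀ a → Generator ((indeterminate *ᴹ adjacency G) a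
                                   ⊖ (adjacency G *ᴹ indeterminate) a)
      column  : ∀ j → Generator (columnSum indeterminate j ⊖ 1ₚ)
      row     : ∀ i → Generator (rowSum indeterminate i ⊖ 1ₚ)
      boolean : ∀ a → Generator (var a ⊗ var a ⊖ var a)

    graphIdeal : Pred Poly 0ℓ
    graphIdeal = Ideal⟨ Generator ⟩

    Exact : Set
    Exact = ExactIdeal 1 graphIdeal

{-# OPTIONS --safe #-}
module Submission where

-- The ideal I_G contains x² - x for every variable x, so it contains every polynomial that vanishes on the
-- automorphisms of G; hence the first theta body lies in the polytope P_G and satisfies every linear equation that
-- holds for all automorphisms.  This settles compact graphs.  For a disjoint union of connected k-regular graphs,
-- the vector of row sums of a block of P ∈ P_G is an eigenvector of a component for the eigenvalue k, hence constant,
-- and likewise for columns.  On the theta body the blocks between non-isomorphic components vanish, so the block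
-- sums form a doubly stochastic matrix.  A permutation in its support (Birkhoff) together with compactness of the
-- components yields an automorphism in the support of P, and subtracting such automorphisms greedily writes P as a
-- convex combination of automorphisms.  Conversely, the constant matrix J/N lies in P_G, so compactness of the union
-- forces every vertex to be movable to every other one.

open import Defs
open import Level using (0ℓ)
open import Algebra.Bundles using (CommutativeRing)
open import Data.Bool.Base using (Bool; true; false; not; if_then_else_)
import Data.Bool.Properties as Bool
open import Data.Fin.Base using (Fin; zero; suc; splitAt; _↑ˡ_; _↑ʳ_)
open import Data.Fin.Permutation using (↔⇒≡)
import Data.Fin.Properties as Fin
import Data.Fin.Subset as Subset
open import Data.Fin.Subset.Induction using (⊃-wellFounded)
import Data.Fin.Subset.Properties as Subset
open import Data.Integer.Base as ℤ using (ℤ; +_; -[1+_])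
import Data.Integer.Properties as ℤ
open import Data.List.Base using (List; []; _∷_; _++_; map; length; foldr; filter; cartesianProduct; allFin)
open import Data.List.Membership.Propositional using () renaming (_∈_ to _∈ᴸ_)
open import Data.List.Membership.Propositional.Properties using (∈-cartesianProduct⁺; ∈-allFin; ∈-filter⁺)
open import Data.List.Properties using (filter-notAll)
open import Data.List.Relation.Unary.All using (All; []; _∷_)
import Data.List.Relation.Unary.All.Properties as All
open import Data.List.Relation.Unary.Any as Any using (here; there)
open import Data.Maybe.Base using (Maybe; just; nothing)
open import Data.Nat.Base as ℕ using (ℕ; zero; suc; NonZero)
open import Data.Nat.Induction using (<-wellFounded)
import Data.Nat.Properties as ℕ
open import Data.Product.Base using (∃; ∃-syntax; Σ-syntax; _×_; _,_; proj₁; proj₂)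
open import Data.Product.Properties using (≡-dec)
open import Data.Product.Properties.WithK using (,-injectiveʳ)
import Data.Sign.Base as Sign
open import Data.Sum.Base using (_⊎_; inj₁; inj₂)
open import Data.Unit.Base using (⊤; tt)
open import Data.Vec.Base using (tabulate)
open import Data.Vec.Functional using (updateAt)
open import Data.Vec.Functional.Properties using (updateAt-updates; updateAt-minimal)
open import Function.Base using (_∘_)
open import Function.Bundles using (_↔_; _⇔_; Inverse; mk↔ₛ′; mk⇔)
open import Function.Construct.Composition using (_↔-∘_)
open import Function.Construct.Identity using (↔-id)
open import Function.Definitions using (Injective)
open import Induction.WellFounded using (Acc; acc)
open import Relation.Binary.Bundles using (Poset)
open import Relation.Binary.Construct.Closure.ReflexiveTransitive using (Star; _◅_) renaming (ε to ε⋆)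
open import Relation.Binary.Definitions using (DecidableEquality)
open import Relation.Binary.PropositionalEquality as ≡ using (_≡_; _≢_)
open import Relation.Binary.Structures using (IsDecTotalOrder)
open import Relation.Nullary using (¬_; Dec; yes; no; does; contradiction)
open import Relation.Nullary.Decidable using (dec-true; dec-false; ¬?; _×-dec_; _⊎-dec_; from-yes)
open import Relation.Unary using (Pred; _∈_; _⊆_; _∩_)

-- Two obstacles shape the argument. The polytope alone is too large when components of different
-- type occur: a matrix in P_G may spread weight over blocks between them. What the theta body adds
-- is a condition on the support only: every nonzero entry is also nonzero at some automorphism, and
-- an automorphism carries a connected component onto an isomorphic one. The condition is used
-- twice: isomorphic components have equally many vertices, so that the row sums and the column sums
-- of a block agree, and the permutation of components found in the support pairs only isomorphic
-- ones. Subtracting an automorphism inside the support never enlarges the support, so every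
-- remainder of the greedy decomposition inherits the condition, and the theta body is not consulted
-- again. The other obstacle is to exhibit compact graphs for the strict inclusion. Instead of
-- analysing cycles, the theorem supplies them itself: disjoint copies of a connected regular
-- compact graph are compact, and so are complements of compact graphs. From the one-vertex graph
-- this yields the triangle and, via K₂, also C₄; the union of these two is the required example.

-- Integer coefficients and finite sums in commutative rings

module RingTools (R : CommutativeRing 0ℓ 0ℓ) where
  open CommutativeRing R hiding (zero)
  open import Algebra.Properties.Semiring.Mult semiring
    using (×-homo-+; ×1-homo-*) renaming (_×_ to _·_)
  open import Algebra.Properties.Ring ring
  open import Algebra.Properties.AbelianGroup +-abelianGroup using (⁻¹-∙-comm)
  open import Relation.Binary.Reasoning.Setoid setoid
  open import Algebra.Solver.Ring.AlmostCommutativeRing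
    using (fromCommutativeRing; _-Raw-AlmostCommutative⟶_)

  ℤ⟦_⟧ : ℤ → Carrier
  ℤ⟦ + n ⟧      = n · 1#
  ℤ⟦ -[1+ n ] ⟧ = - (suc n · 1#)

  private
    cancel-1# : ∀ x y → x - y ≈ (1# + x) - (1# + y)
    cancel-1# x y = sym (begin
      (1# + x) - (1# + y)         ≈⟨ +-congˡ (⁻¹-∙-comm 1# y) ⟨
      (1# + x) + (- 1# + - y)     ≈⟨ +-congʳ (+-comm 1# x) ⟩
      (x + 1#) + (- 1# + - y)     ≈⟨ +-assoc x 1# _ ⟩
      x + (1# + (- 1# + - y))     ≈⟨ +-congˡ (+-assoc 1# _ _) ⟨
      x + ((1# + - 1#) + - y)     ≈⟨ +-congˡ (+-congʳ (-‿inverseʳ 1#)) ⟩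
      x + (0# + - y)              ≈⟨ +-congˡ (+-identityˡ _) ⟩
      x - y                       ∎)

    ⊖-homo : ∀ m n → ℤ⟦ m ℤ.⊖ n ⟧ ≈ m · 1# - n · 1#
    ⊖-homo zero    zero    = sym (-‿inverseʳ 0#)
    ⊖-homo zero    (suc n) = sym (+-identityˡ _)
    ⊖-homo (suc m) zero    = sym (trans (+-congˡ -0#≈0#) (+-identityʳ _))
    ⊖-homo (suc m) (suc n) = begin
      ℤ⟦ suc m ℤ.⊖ suc n ⟧        ≡⟨ ≡.cong ℤ⟦_⟧ (ℤ.[1+m]⊖[1+n]≡m⊖n m n) ⟩
      ℤ⟦ m ℤ.⊖ n ⟧                ≈⟨ ⊖-homo m n ⟩
      m · 1# - n · 1#             ≈⟨ cancel-1# _ _ ⟩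
      suc m · 1# - suc n · 1#     ∎

    +-homo : ∀ i j → ℤ⟦ i ℤ.+ j ⟧ ≈ ℤ⟦ i ⟧ + ℤ⟦ j ⟧
    +-homo (+ m)    (+ n)    = ×-homo-+ 1# m n
    +-homo (+ m)    -[1+ n ] = ⊖-homo m (suc n)
    +-homo -[1+ m ] (+ n)    = trans (⊖-homo n (suc m)) (+-comm _ _)
    +-homo -[1+ m ] -[1+ n ] = begin
      - (suc (suc (m ℕ.+ n)) · 1#)         ≡⟨ ≡.cong (λ k → - (suc k · 1#)) (≡.sym (ℕ.+-suc m n)) ⟩
      - ((suc m ℕ.+ suc n) · 1#)           ≈⟨ -‿cong (×-homo-+ 1# (suc m) (suc n)) ⟩
      - (suc m · 1# + suc n · 1#)          ≈⟨ ⁻¹-∙-comm _ _ ⟨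
      - (suc m · 1#) + - (suc n · 1#)      ∎

    -‿homo : ∀ i → ℤ⟦ ℤ.- i ⟧ ≈ - ℤ⟦ i ⟧
    -‿homo (+ zero)  = sym -0#≈0#
    -‿homo (+ suc n) = refl
    -‿homo -[1+ n ]  = sym (-‿involutive _)

    *-homo : ∀ i j → ℤ⟦ i ℤ.* j ⟧ ≈ ℤ⟦ i ⟧ * ℤ⟦ j ⟧
    *-homo (+ m) (+ n) = begin
      ℤ⟦ Sign.+ ℤ.◃ m ℕ.* n ⟧    ≡⟨ ≡.cong ℤ⟦_⟧ (ℤ.+◃n≡+n (m ℕ.* n)) ⟩
      (m ℕ.* n) · 1#             ≈⟨ ×1-homo-* m n ⟩
      m · 1# * (n · 1#)          ∎
    *-homo (+ m) -[1+ n ] = begin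
      ℤ⟦ Sign.- ℤ.◃ m ℕ.* suc n ⟧  ≡⟨ ≡.cong ℤ⟦_⟧ (ℤ.-◃n≡-n (m ℕ.* suc n)) ⟩
      ℤ⟦ ℤ.- (+ (m ℕ.* suc n)) ⟧   ≈⟨ -‿homo (+ (m ℕ.* suc n)) ⟩
      - ((m ℕ.* suc n) · 1#)       ≈⟨ -‿cong (×1-homo-* m (suc n)) ⟩
      - (m · 1# * (suc n · 1#))    ≈⟨ -‿distribʳ-* _ _ ⟩
      m · 1# * - (suc n · 1#)      ∎
    *-homo -[1+ m ] (+ n) = begin
      ℤ⟦ Sign.- ℤ.◃ suc m ℕ.* n ⟧  ≡⟨ ≡.cong ℤ⟦_⟧ (ℤ.-◃n≡-n (suc m ℕ.* n)) ⟩
      ℤ⟦ ℤ.- (+ (suc m ℕ.* n)) ⟧   ≈⟨ -‿homo (+ (suc m ℕ.* n)) ⟩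
      - ((suc m ℕ.* n) · 1#)       ≈⟨ -‿cong (×1-homo-* (suc m) n) ⟩
      - (suc m · 1# * (n · 1#))    ≈⟨ -‿distribˡ-* _ _ ⟩
      - (suc m · 1#) * (n · 1#)    ∎
    *-homo -[1+ m ] -[1+ n ] = begin
      (suc m ℕ.* suc n) · 1#               ≈⟨ ×1-homo-* (suc m) (suc n) ⟩
      suc m · 1# * (suc n · 1#)            ≈⟨ -‿involutive _ ⟨
      - (- (suc m · 1# * (suc n · 1#)))    ≈⟨ -‿cong (-‿distribˡ-* _ _) ⟩
      - (- (suc m · 1#) * (suc n · 1#))    ≈⟨ -‿distribʳ-* _ _ ⟩
      - (suc m · 1#) * - (suc n · 1#)      ∎

    -- Coefficients are taken in ℤ, where 1 - 1 computes to 0; in R itself the solver could not cancel terms.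
    ℤ⟶R : ℤ.+-*-rawRing -Raw-AlmostCommutative⟶ fromCommutativeRing R
    ℤ⟶R = record
      { ⟦_⟧ = ℤ⟦_⟧ ; +-homo = +-homo ; *-homo = *-homo ; -‿homo = -‿homo
      ; 0-homo = refl ; 1-homo = +-identityʳ 1# }

    weaklyDecide : ∀ i j → Maybe (ℤ⟦ i ⟧ ≈ ℤ⟦ j ⟧)
    weaklyDecide i j with i ℤ.≟ j
    ... | yes i≡j = just (reflexive (≡.cong ℤ⟦_⟧ i≡j))
    ... | no  _   = nothing

  open import Algebra.Solver.Ring ℤ.+-*-rawRing (fromCommutativeRing R) ℤ⟶R weaklyDecide public
    using (solve; _:=_; _:+_; _:*_; _:-_; :-_; con)

  open import Algebra.Properties.Semiring.Sum semiring public
    using (sum; sum-permute; sum-cong-≋; ∑-distrib-+; ∑-comm; *-distribˡ-sum; *-distribʳ-sum; sum-replicate-zero)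

  sum-zero : ∀ {n} {f : Fin n → Carrier} → (∀ i → f i ≈ 0#) → sum f ≈ 0#
  sum-zero {n} f≈0 = trans (sum-cong-≋ f≈0) (sum-replicate-zero n)

  sum-neg : ∀ {n} (f : Fin n → Carrier) → sum (λ i → - f i) ≈ - sum f
  sum-neg {zero}  f = sym -0#≈0#
  sum-neg {suc n} f = trans (+-congˡ (sum-neg (f ∘ suc))) (⁻¹-∙-comm _ _)

  sum-distrib-- : ∀ {n} (f g : Fin n → Carrier) → sum (λ i → f i - g i) ≈ sum f - sum g
  sum-distrib-- f g = trans (∑-distrib-+ f (λ i → - g i)) (+-congˡ (sum-neg g))

  indicator : Bool → Carrier
  indicator b = if b then 1# else 0#

  opaque
    -- Kept abstract: it is used only through its values on and off the diagonal, so that a case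
    -- split on `i ≟ j` leaves it in place.
    δ : ∀ {n} → Fin n → Fin n → Carrier
    δ i j = indicator (does (i Fin.≟ j))

    δ-refl : ∀ {n} (i : Fin n) → δ i i ≈ 1#
    δ-refl i rewrite dec-true (i Fin.≟ i) ≡.refl = refl

    δ-≢ : ∀ {n} {i j : Fin n} → i ≢ j → δ i j ≈ 0#
    δ-≢ {i = i} {j} i≢j rewrite dec-false (i Fin.≟ j) i≢j = refl

  sum-single : ∀ {n} (f : Fin n → Carrier) (i : Fin n) → (∀ j → i ≢ j → f j ≈ 0#) → sum f ≈ f i
  sum-single {suc n} f zero    f≈0 =
    trans (+-congˡ (sum-zero (λ j → f≈0 (suc j) λ ()))) (+-identityʳ _)
  sum-single {suc n} f (suc i) f≈0 =
    trans (+-cong (f≈0 zero λ ()) (sum-single (f ∘ suc) i λ j i≢j → f≈0 (suc j) (i≢j ∘ Fin.suc-injective)))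
          (+-identityˡ _)

  sum-δˡ : ∀ {n} (i : Fin n) (f : Fin n → Carrier) → sum (λ j → δ i j * f j) ≈ f i
  sum-δˡ i f =
    trans (sum-single _ i λ j i≢j → trans (*-congʳ (δ-≢ i≢j)) (zeroˡ _))
          (trans (*-congʳ (δ-refl i)) (*-identityˡ _))

  indicator-injective : ¬ (0# ≈ 1#) → ∀ {b c} → indicator b ≈ indicator c → b ≡ c
  indicator-injective 0≉1 {false} {false} eq = ≡.refl
  indicator-injective 0≉1 {false} {true}  eq = contradiction eq 0≉1
  indicator-injective 0≉1 {true}  {false} eq = contradiction (sym eq) 0≉1
  indicator-injective 0≉1 {true}  {true}  eq = ≡.refl

-- Order and finite sums in the real field

module OrderedField (ℝ : RealNumbers) where
  open RealNumbers ℝ public hiding (zero)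
  open RingTools commutativeRing public
  open IsDecTotalOrder isDecTotalOrder public
    using (isPartialOrder; antisym; total; _≟_; _≤?_)
    renaming (refl to ≤-refl; reflexive to ≤-reflexive; trans to ≤-trans)
  open import Algebra.Properties.Ring ring public
    using (-‿involutive; -0#≈0#; -‿distribˡ-*; -‿distribʳ-*; x∙y⁻¹≈ε⇒x≈y)

  poset : Poset _ _ _
  poset = record { isPartialOrder = isPartialOrder }

  import Relation.Binary.Reasoning.PartialOrder as PartialOrderReasoning
  module ≤-Reasoning = PartialOrderReasoning poset
  open ≤-Reasoning

  module Order where
    open import Relation.Binary.Construct.NonStrictToStrict _≈_ _≤_ public
      using (<⇒≱)

  +-mono-≤ : ∀ {a b c d} → a ≤ b → c ≤ d → a + c ≤ b + d
  +-mono-≤ {a} {b} {c} {d} a≤b c≤d = begin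
    a + c  ≤⟨ +-monoʳ-≤ a c≤d ⟩
    a + d  ≈⟨ +-comm a d ⟩
    d + a  ≤⟨ +-monoʳ-≤ d a≤b ⟩
    d + b  ≈⟨ +-comm d b ⟩
    b + d  ∎

  x≤y⇒0≤y-x : ∀ {x y} → x ≤ y → 0# ≤ y - x
  x≤y⇒0≤y-x {x} {y} x≤y = begin
    0#       ≈⟨ -‿inverseʳ x ⟨
    x - x    ≤⟨ +-mono-≤ x≤y ≤-refl ⟩
    y - x    ∎

  0≤y-x⇒x≤y : ∀ {x y} → 0# ≤ y - x → x ≤ y
  0≤y-x⇒x≤y {x} {y} 0≤y-x = begin
    x            ≈⟨ +-identityʳ x ⟨
    x + 0#       ≤⟨ +-monoʳ-≤ x 0≤y-x ⟩
    x + (y - x)  ≈⟨ solve 2 (λ x y → x :+ (y :- x) := y) refl x y ⟩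
    y            ∎

  neg-mono-≤ : ∀ {x y} → x ≤ y → - y ≤ - x
  neg-mono-≤ {x} {y} x≤y = 0≤y-x⇒x≤y (≤-trans (x≤y⇒0≤y-x x≤y)
    (≤-reflexive (solve 2 (λ x y → y :- x := :- x :- :- y) refl x y)))

  +-nonNegative : ∀ {x y} → 0# ≤ x → 0# ≤ y → 0# ≤ x + y
  +-nonNegative 0≤x 0≤y = ≤-trans (≤-reflexive (sym (+-identityʳ 0#))) (+-mono-≤ 0≤x 0≤y)

  *-monoʳ-≤ : ∀ {x y z} → 0# ≤ x → y ≤ z → x * y ≤ x * z
  *-monoʳ-≤ {x} {y} {z} 0≤x y≤z = 0≤y-x⇒x≤y (begin
    0#             ≤⟨ *-nonNegative 0≤x (x≤y⇒0≤y-x y≤z) ⟩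
    x * (z - y)    ≈⟨ solve 3 (λ x y z → x :* (z :- y) := x :* z :- x :* y) refl x y z ⟩
    x * z - x * y  ∎)

  square-nonNegative : ∀ x → 0# ≤ x * x
  square-nonNegative x with total 0# x
  ... | inj₁ 0≤x = *-nonNegative 0≤x 0≤x
  ... | inj₂ x≤0 = begin
    0#         ≤⟨ *-nonNegative 0≤-x 0≤-x ⟩
    - x * - x  ≈⟨ solve 1 (λ x → :- x :* :- x := x :* x) refl x ⟩
    x * x      ∎
    where
    0≤-x : 0# ≤ - x
    0≤-x = ≤-trans (≤-reflexive (sym -0#≈0#)) (neg-mono-≤ x≤0)

  0≤1 : 0# ≤ 1#
  0≤1 = ≤-trans (square-nonNegative 1#) (≤-reflexive (*-identityˡ 1#))

  0<1 : 0# < 1#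
  0<1 = 0≤1 , 0≉1

  0<⇒≉ : ∀ {x} → 0# < x → ¬ (x ≈ 0#)
  0<⇒≉ (_ , 0≉x) x≈0 = 0≉x (sym x≈0)

  nonNegative∧≉0⇒0< : ∀ {x} → 0# ≤ x → ¬ (x ≈ 0#) → 0# < x
  nonNegative∧≉0⇒0< 0≤x x≉0 = 0≤x , x≉0 ∘ sym

  0<-resp-≤ : ∀ {x y} → 0# < x → x ≤ y → 0# < y
  0<-resp-≤ {x} {y} 0<x x≤y = begin-strict
    0#  <⟨ 0<x ⟩
    x   ≤⟨ x≤y ⟩
    y   ∎

  0<⇒≰0 : ∀ {x} → 0# < x → ¬ (x ≤ 0#)
  0<⇒≰0 = Order.<⇒≱ antisym

  ≰⇒0<- : ∀ {x y} → ¬ (y ≤ x) → 0# < y - x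
  ≰⇒0<- {x} {y} y≰x with total x y
  ... | inj₂ y≤x = contradiction y≤x y≰x
  ... | inj₁ x≤y = nonNegative∧≉0⇒0< (x≤y⇒0≤y-x x≤y)
    λ y-x≈0 → y≰x (≤-reflexive (x∙y⁻¹≈ε⇒x≈y y x y-x≈0))

  +-mono-<-≤ : ∀ {x y} → 0# < x → 0# ≤ y → 0# < x + y
  +-mono-<-≤ {x} {y} 0<x 0≤y = 0<-resp-≤ 0<x (≤-trans (≤-reflexive (sym (+-identityʳ x))) (+-monoʳ-≤ x 0≤y))

  *-cancelˡ-0 : ∀ {x y} → ¬ (x ≈ 0#) → x * y ≈ 0# → y ≈ 0#
  *-cancelˡ-0 {x} {y} x≉0 xy≈0 with x⁻¹ , xx⁻¹≈1 ← inverse x x≉0 = begin-equality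
    y              ≈⟨ *-identityˡ y ⟨
    1# * y         ≈⟨ *-congʳ xx⁻¹≈1 ⟨
    x * x⁻¹ * y    ≈⟨ solve 3 (λ x i y → x :* i :* y := i :* (x :* y)) refl x x⁻¹ y ⟩
    x⁻¹ * (x * y)  ≈⟨ *-congˡ xy≈0 ⟩
    x⁻¹ * 0#       ≈⟨ zeroʳ x⁻¹ ⟩
    0#             ∎

  *-positive : ∀ {x y} → 0# < x → 0# < y → 0# < x * y
  *-positive 0<x 0<y = nonNegative∧≉0⇒0< (*-nonNegative (proj₁ 0<x) (proj₁ 0<y))
    λ xy≈0 → 0<⇒≉ 0<y (*-cancelˡ-0 (0<⇒≉ 0<x) xy≈0)

  positive-inverse : ∀ {x} → 0# < x → ∃[ y ] (0# < y × x * y ≈ 1#)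
  positive-inverse {x} 0<x with y , xy≈1 ← inverse x (0<⇒≉ 0<x) with total 0# y
  ... | inj₁ 0≤y = y , nonNegative∧≉0⇒0< 0≤y (λ y≈0 → 0≉1 (trans (sym (zeroʳ x)) (trans (*-congˡ (sym y≈0)) xy≈1))) , xy≈1
  ... | inj₂ y≤0 = contradiction (begin
      1#      ≈⟨ xy≈1 ⟨
      x * y   ≤⟨ *-monoʳ-≤ (proj₁ 0<x) y≤0 ⟩
      x * 0#  ≈⟨ zeroʳ x ⟩
      0#      ∎) (0<⇒≰0 0<1)

  idempotent⇒0∨1 : ∀ {x} → x * x - x ≈ 0# → x ≈ 0# ⊎ x ≈ 1#
  idempotent⇒0∨1 {x} x²-x≈0 with x ≟ 0#
  ... | yes x≈0 = inj₁ x≈0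
  ... | no  x≉0 = inj₂ (x∙y⁻¹≈ε⇒x≈y x 1# (*-cancelˡ-0 x≉0
    (trans (trans (distribˡ x x (- 1#)) (+-congˡ (trans (sym (-‿distribʳ-* x 1#)) (-‿cong (*-identityʳ x))))) x²-x≈0)))

  sum-mono-≤ : ∀ {n} {f g : Fin n → Carrier} → (∀ i → f i ≤ g i) → sum f ≤ sum g
  sum-mono-≤ {zero}  f≤g = ≤-refl
  sum-mono-≤ {suc n} f≤g = +-mono-≤ (f≤g zero) (sum-mono-≤ (f≤g ∘ suc))

  sum-nonNegative : ∀ {n} {f : Fin n → Carrier} → (∀ i → 0# ≤ f i) → 0# ≤ sum f
  sum-nonNegative {n} 0≤f = ≤-trans (≤-reflexive (sym (sum-replicate-zero n))) (sum-mono-≤ 0≤f)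

  term≤sum : ∀ {n} {f : Fin n → Carrier} → (∀ i → 0# ≤ f i) → ∀ i → f i ≤ sum f
  term≤sum {suc n} {f} 0≤f zero =
    ≤-trans (≤-reflexive (sym (+-identityʳ _))) (+-monoʳ-≤ _ (sum-nonNegative (0≤f ∘ suc)))
  term≤sum {suc n} {f} 0≤f (suc i) =
    ≤-trans (≤-reflexive (sym (+-identityˡ _))) (+-mono-≤ (0≤f zero) (term≤sum (0≤f ∘ suc) i))

  -- Meant for stochastic matrices: two entries equal to 1 in the same row or column would push its
  -- sum up to 2.
  two-terms≤sum : ∀ {n} {f : Fin n → Carrier} → (∀ i → 0# ≤ f i) → ∀ {i j} → i ≢ j → f i + f j ≤ sum f
  two-terms≤sum {suc n} 0≤f {zero}  {zero}  i≢j = contradiction ≡.refl i≢j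
  two-terms≤sum {suc n} 0≤f {zero}  {suc j} i≢j = +-monoʳ-≤ _ (term≤sum (0≤f ∘ suc) j)
  two-terms≤sum {suc n} 0≤f {suc i} {zero}  i≢j =
    ≤-trans (≤-reflexive (+-comm _ _)) (+-monoʳ-≤ _ (term≤sum (0≤f ∘ suc) i))
  two-terms≤sum {suc n} 0≤f {suc i} {suc j} i≢j =
    ≤-trans (two-terms≤sum (0≤f ∘ suc) (i≢j ∘ ≡.cong suc))
      (≤-trans (≤-reflexive (sym (+-identityˡ _))) (+-mono-≤ (0≤f zero) ≤-refl))

  sum≈0⇒≈0 : ∀ {n} {f : Fin n → Carrier} → (∀ i → 0# ≤ f i) → sum f ≈ 0# → ∀ i → f i ≈ 0#
  sum≈0⇒≈0 0≤f ∑f≈0 i = antisym (≤-trans (term≤sum 0≤f i) (≤-reflexive ∑f≈0)) (0≤f i)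

  sum≉0⇒∃≉0 : ∀ {n} {f : Fin n → Carrier} → ¬ (sum f ≈ 0#) → ∃[ i ] ¬ (f i ≈ 0#)
  sum≉0⇒∃≉0 {n} {f} ∑f≉0 = Fin.¬∀⟶∃¬ n _ (λ i → f i ≟ 0#) (∑f≉0 ∘ sum-zero)

  minimum : ∀ {n} → Fin n → (f : Fin n → Carrier) → ∃[ i ] ∀ j → f i ≤ f j
  minimum {suc zero}    _ f = zero , λ { zero → ≤-refl }
  minimum {suc (suc n)} _ f with minimum zero (f ∘ suc)
  ... | i , fᵢ≤ with total (f zero) (f (suc i))
  ...   | inj₁ f₀≤fᵢ = zero  , λ { zero → ≤-refl ; (suc j) → ≤-trans f₀≤fᵢ (fᵢ≤ j) }
  ...   | inj₂ fᵢ≤f₀ = suc i , λ { zero → fᵢ≤f₀ ; (suc j) → fᵢ≤ j }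

-- Evaluation of polynomials and generated ideals

module PolynomialTools (ℝ : RealNumbers) (X : Set) where
  open OrderedField ℝ
  open Over ℝ
  open Polynomials commutativeRing X
  open CommutativeRing polyRing public using () renaming
    ( _-_ to _⊖_; +-congˡ to ⊕-congˡ; *-congˡ to ⊗-congˡ; *-congʳ to ⊗-congʳ; zeroʳ to ⊗-zeroʳ
    ; +-identityʳ to ⊕-identityʳ; setoid to ≋-setoid; ring to polyRing-ring )
  module P = RingTools polyRing
  import Relation.Binary.Reasoning.Setoid as SetoidReasoning
  module ≋-Reasoning = SetoidReasoning ≋-setoid
  import Algebra.Properties.Ring as RingProperties
  module PolyRingProperties = RingProperties polyRing-ring

  Point : Set
  Point = X → Carrier

  eval-cong : ∀ x {p q} → p ≋ q → eval x p ≈ eval x q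
  eval-cong x ≋-refl            = refl
  eval-cong x (≋-sym e)         = sym (eval-cong x e)
  eval-cong x (≋-trans e f)     = trans (eval-cong x e) (eval-cong x f)
  eval-cong x (⊕-cong e f)      = +-cong (eval-cong x e) (eval-cong x f)
  eval-cong x (⊗-cong e f)      = *-cong (eval-cong x e) (eval-cong x f)
  eval-cong x (⊝-cong e)        = -‿cong (eval-cong x e)
  eval-cong x (⊕-assoc p q r)   = +-assoc _ _ _
  eval-cong x (⊕-comm p q)      = +-comm _ _
  eval-cong x (⊕-identityˡ p)   = +-identityˡ _
  eval-cong x (⊝-inverseˡ p)    = -‿inverseˡ _
  eval-cong x (⊗-assoc p q r)   = *-assoc _ _ _
  eval-cong x (⊗-comm p q)      = *-comm _ _
  eval-cong x (⊗-identityˡ p)   = *-identityˡ _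
  eval-cong x (⊗-distribˡ p q r) = distribˡ _ _ _
  eval-cong x (con-cong e)      = e
  eval-cong x (con-+ a b)       = refl
  eval-cong x (con-* a b)       = refl

  eval-congˡ : ∀ {x y : Point} → (∀ a → x a ≈ y a) → ∀ p → eval x p ≈ eval y p
  eval-congˡ x≈y (con c) = refl
  eval-congˡ x≈y (var a) = x≈y a
  eval-congˡ x≈y (p ⊕ q) = +-cong (eval-congˡ x≈y p) (eval-congˡ x≈y q)
  eval-congˡ x≈y (p ⊗ q) = *-cong (eval-congˡ x≈y p) (eval-congˡ x≈y q)
  eval-congˡ x≈y (⊝ p)   = -‿cong (eval-congˡ x≈y p)

  eval-sum : ∀ x {n} (f : Fin n → Poly) → eval x (P.sum f) ≈ sum (eval x ∘ f)
  eval-sum x {zero}  f = refl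
  eval-sum x {suc n} f = +-congˡ (eval-sum x (f ∘ suc))

  con-neg : ∀ c → con (- c) ≋ ⊝ con c
  con-neg c = PolyRingProperties.+-inverseˡ-unique _ _
    (≋-trans (≋-sym (con-+ (- c) c)) (con-cong (-‿inverseˡ c)))

  Vanishes : Pred Poly 0ℓ → Point → Set
  Vanishes S x = ∀ {g} → S g → eval x g ≈ 0#

  vanishes⇒zeroSet : ∀ {S x} → Vanishes S x → x ∈ zeroSet Ideal⟨ S ⟩
  vanishes⇒zeroSet v (generator g∈S)  = v g∈S
  vanishes⇒zeroSet v zero-mem         = refl
  vanishes⇒zeroSet v (add-mem p q)    =
    trans (+-cong (vanishes⇒zeroSet v p) (vanishes⇒zeroSet v q)) (+-identityˡ 0#)
  vanishes⇒zeroSet v (mul-mem p q)    = trans (*-congˡ (vanishes⇒zeroSet v q)) (zeroʳ _)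
  vanishes⇒zeroSet v (resp-mem p≋q p) = trans (eval-cong _ (≋-sym p≋q)) (vanishes⇒zeroSet v p)

  module _ {S : Pred Poly 0ℓ} where
    neg-mem : ∀ {p} → Ideal⟨ S ⟩ p → Ideal⟨ S ⟩ (⊝ p)
    neg-mem {p} p∈I = resp-mem
      (≋-trans (⊗-congʳ (con-neg 1#)) (PolyRingProperties.-1*x≈-x p)) (mul-mem (con (- 1#)) p∈I)

    -- Here `e` behaves like an indicator polynomial of the point `σ`: modulo the ideal, multiplying
    -- `e` by a variable only rescales it by the coordinate of `σ`.
    SpecialisesTo : Point → Pred Poly 0ℓ
    SpecialisesTo σ e = ∀ a → Ideal⟨ S ⟩ ((var a ⊖ con (σ a)) ⊗ e)

    -- The polynomials that act on `e` as their value at `σ` are closed under the ring operations;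
    -- for products this rests on `pq - p̄q̄ = p(q - q̄) + q̄(p - p̄)`.
    specialise : ∀ {σ e} → SpecialisesTo σ e → ∀ g → Ideal⟨ S ⟩ ((g ⊖ con (eval σ g)) ⊗ e)
    specialise {σ} {e} s (con c) = resp-mem
      (P.solve 2 (λ c e → P.con (+ 0) P.:= (c P.:- c) P.:* e) ≋-refl (con c) e) zero-mem
    specialise s (var a) = s a
    specialise {σ} {e} s (p ⊕ q) = resp-mem
      (≋-trans (P.solve 5 (λ p q p̄ q̄ e → (p P.:- p̄) P.:* e P.:+ (q P.:- q̄) P.:* e
                                P.:= ((p P.:+ q) P.:- (p̄ P.:+ q̄)) P.:* e) ≋-refl p q _ _ e)
               (⊗-congʳ (⊕-congˡ (⊝-cong (≋-sym (con-+ _ _))))))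
      (add-mem (specialise s p) (specialise s q))
    specialise {σ} {e} s (p ⊗ q) = resp-mem
      (≋-trans (P.solve 5 (λ p q p̄ q̄ e → p P.:* ((q P.:- q̄) P.:* e) P.:+ q̄ P.:* ((p P.:- p̄) P.:* e)
                                P.:= ((p P.:* q) P.:- (p̄ P.:* q̄)) P.:* e) ≋-refl p q _ _ e)
               (⊗-congʳ (⊕-congˡ (⊝-cong (≋-sym (con-* _ _))))))
      (add-mem (mul-mem p (specialise s q)) (mul-mem (con (eval σ q)) (specialise s p)))
    specialise {σ} {e} s (⊝ p) = resp-mem
      (≋-trans (P.solve 3 (λ p p̄ e → P.:- ((p P.:- p̄) P.:* e) P.:= (P.:- p P.:- P.:- p̄) P.:* e) ≋-refl p _ e)
               (⊗-congʳ (⊕-congˡ (⊝-cong (≋-sym (con-neg _))))))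
      (neg-mem (specialise s p))

    unit-multiple-mem : ∀ {c e} → ¬ (c ≈ 0#) → Ideal⟨ S ⟩ (con c ⊗ e) → Ideal⟨ S ⟩ e
    unit-multiple-mem {c} {e} c≉0 ce∈I with c⁻¹ , cc⁻¹≈1 ← inverse c c≉0 = resp-mem
      (begin
        con c⁻¹ ⊗ (con c ⊗ e)  ≈⟨ P.solve 3 (λ i c e → i P.:* (c P.:* e) P.:= (c P.:* i) P.:* e) ≋-refl _ _ e ⟩
        (con c ⊗ con c⁻¹) ⊗ e  ≈⟨ ⊗-congʳ (con-* c c⁻¹) ⟨
        con (c * c⁻¹) ⊗ e      ≈⟨ ⊗-congʳ (con-cong cc⁻¹≈1) ⟩
        con 1# ⊗ e             ≈⟨ ⊗-identityˡ e ⟩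
        e                      ∎) (mul-mem (con c⁻¹) ce∈I)
      where open ≋-Reasoning

  -- Membership in ideals that contain `x² - x` for every variable

  module BooleanIdeal
    (S : Pred Poly 0ℓ)
    (vanishes? : ∀ x → Vanishes S x ⊎ ∃[ g ] (S g × ¬ (eval x g ≈ 0#)))
    (boolean : ∀ a → S (var a ⊗ var a ⊖ var a))
    (_≟ˣ_ : DecidableEquality X)
    (variables : List X) (complete : ∀ a → a ∈ᴸ variables)
    where

    private
      I : Pred Poly 0ℓ
      I = Ideal⟨ S ⟩

      NonZeroOn : Poly → Set
      NonZeroOn f = ∃[ x ] (x ∈ zeroSet I × ¬ (eval x f ≈ 0#))

      _[_↦_] : Point → X → Carrier → Point
      (σ [ a ↦ c ]) b = if does (a ≟ˣ b) then c else σ b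

    -- f is decided at every 0/1 point separately: modulo I, 1 is the sum of the products of the x's and (1 - x)'s,
    -- and on each such product e every polynomial g acts as the constant g(σ).
    decideMultiple : ∀ f (as : List X) σ e →
      (∀ a → a ∈ᴸ as ⊎ I ((var a ⊖ con (σ a)) ⊗ e)) → I (f ⊗ e) ⊎ NonZeroOn f
    decideMultiple f [] σ e s = leaf (vanishes? σ)
      where
      s′ : SpecialisesTo σ e
      s′ a with inj₂ m ← s a = m

      leaf : Vanishes S σ ⊎ ∃[ g ] (S g × ¬ (eval σ g ≈ 0#)) → I (f ⊗ e) ⊎ NonZeroOn f
      leaf (inj₁ v) with eval σ f ≟ 0#
      ... | no  f≉0 = inj₂ (σ , vanishes⇒zeroSet v , f≉0)
      ... | yes f≈0 = inj₁ (resp-mem (begin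
          (f ⊖ con (eval σ f)) ⊗ e  ≈⟨ ⊗-congʳ (⊕-congˡ (⊝-cong (con-cong f≈0))) ⟩
          (f ⊖ con 0#) ⊗ e          ≈⟨ P.solve 2 (λ f e → (f P.:- P.con (+ 0)) P.:* e P.:= f P.:* e) ≋-refl f e ⟩
          f ⊗ e                     ∎) (specialise s′ f))
        where open ≋-Reasoning
      -- Outside the zero set some generator `g` has a nonzero value at `σ`. Both `g e` and
      -- `(g - g(σ)) e` lie in the ideal, hence so does the unit multiple `g(σ) e`, and with it `e`
      -- itself.
      leaf (inj₂ (g , g∈S , g≉0)) = inj₁ (mul-mem f (unit-multiple-mem g≉0 (resp-mem
        (P.solve 3 (λ g ḡ e → e P.:* g P.:+ P.:- ((g P.:- ḡ) P.:* e) P.:= ḡ P.:* e) ≋-refl g _ e)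
        (add-mem (mul-mem e (generator g∈S)) (neg-mem (specialise s′ g))))))
    decideMultiple f (a ∷ as) σ e s =
      branch (decideMultiple f as (σ [ a ↦ 1# ]) (var a ⊗ e) at1) (decideMultiple f as (σ [ a ↦ 0# ]) (e ⊖ var a ⊗ e) at0)
      where
      idempotent : I ((var a ⊗ var a ⊖ var a) ⊗ e)
      idempotent = resp-mem (⊗-comm _ _) (mul-mem e (generator (boolean a)))

      at1 : ∀ b → b ∈ᴸ as ⊎ I ((var b ⊖ con ((σ [ a ↦ 1# ]) b)) ⊗ (var a ⊗ e))
      at1 b with a ≟ˣ b
      ... | yes ≡.refl = inj₂ (resp-mem (begin
          (var a ⊗ var a ⊖ var a) ⊗ e
            ≈⟨ ⊗-congʳ (⊕-congˡ (⊝-cong (≋-sym (⊗-identityˡ _)))) ⟩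
          (var a ⊗ var a ⊖ con 1# ⊗ var a) ⊗ e
            ≈⟨ P.solve 3 (λ a i e → (a P.:* a P.:- i P.:* a) P.:* e P.:= (a P.:- i) P.:* (a P.:* e)) ≋-refl _ _ e ⟩
          (var a ⊖ con 1#) ⊗ (var a ⊗ e) ∎) idempotent)
        where open ≋-Reasoning
      ... | no a≢b with s b
      ...   | inj₁ (here b≡a) = contradiction (≡.sym b≡a) a≢b
      ...   | inj₁ (there b∈) = inj₁ b∈
      ...   | inj₂ m = inj₂ (resp-mem
        (P.solve 3 (λ a g e → a P.:* (g P.:* e) P.:= g P.:* (a P.:* e)) ≋-refl (var a) _ e) (mul-mem (var a) m))

      at0 : ∀ b → b ∈ᴸ as ⊎ I ((var b ⊖ con ((σ [ a ↦ 0# ]) b)) ⊗ (e ⊖ var a ⊗ e))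
      at0 b with a ≟ˣ b
      ... | yes ≡.refl = inj₂ (resp-mem
          (P.solve 2 (λ a e → P.:- ((a P.:* a P.:- a) P.:* e) P.:= (a P.:- P.con (+ 0)) P.:* (e P.:- a P.:* e)) ≋-refl (var a) e)
          (neg-mem idempotent))
      ... | no a≢b with s b
      ...   | inj₁ (here b≡a) = contradiction (≡.sym b≡a) a≢b
      ...   | inj₁ (there b∈) = inj₁ b∈
      ...   | inj₂ m = inj₂ (resp-mem
        (P.solve 3 (λ a g e → g P.:* e P.:+ P.:- (a P.:* (g P.:* e)) P.:= g P.:* (e P.:- a P.:* e)) ≋-refl (var a) _ e)
        (add-mem m (neg-mem (mul-mem (var a) m))))

      branch : I (f ⊗ (var a ⊗ e)) ⊎ NonZeroOn f → I (f ⊗ (e ⊖ var a ⊗ e)) ⊎ NonZeroOn f → I (f ⊗ e) ⊎ NonZeroOn f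
      branch (inj₂ x) _        = inj₂ x
      branch _        (inj₂ x) = inj₂ x
      branch (inj₁ m) (inj₁ n) = inj₁ (resp-mem
        (P.solve 3 (λ f a e → f P.:* (a P.:* e) P.:+ f P.:* (e P.:- a P.:* e) P.:= f P.:* e) ≋-refl f (var a) e)
        (add-mem m n))

    -- A disjunction rather than an implication: when `f` is not found in the ideal, an actual zero
    -- of the ideal with `f ≠ 0` is returned, and for graphs this zero is an automorphism.
    mem⊎nonZeroOn : ∀ f → f ∈ I ⊎ ∃[ x ] (x ∈ zeroSet I × ¬ (eval x f ≈ 0#))
    -- The initial product is 1, and the zero point is a placeholder: every variable is still
    -- waiting in the list, so each coordinate is overwritten by a split.
    mem⊎nonZeroOn f with decideMultiple f variables (λ _ → 0#) (con 1#) (inj₁ ∘ complete)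
    ... | inj₁ m = inj₁ (resp-mem (≋-trans (⊗-comm _ _) (⊗-identityˡ f)) m)
    ... | inj₂ x = inj₂ x

-- Convex hulls, closures and theta bodies

module ThetaBody (ℝ : RealNumbers) (X : Set) where
  open OrderedField ℝ
  open ≤-Reasoning
  open Over ℝ
  open Polynomials commutativeRing X
  open PolynomialTools ℝ X

  private
    linearCombination : List Term → Poly
    linearCombination = foldr (λ t q → term t ⊕ q) (con 0#)

    linearCombination-++ : ∀ ts us → linearCombination (ts ++ us) ≋ linearCombination ts ⊕ linearCombination us
    linearCombination-++ []       us = ≋-sym (⊕-identityˡ _)
    linearCombination-++ (t ∷ ts) us = ≋-trans (⊕-congˡ (linearCombination-++ ts us)) (≋-sym (⊕-assoc _ _ _))

    scale : Carrier → Term → Term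
    scale c (d , xs) = c * d , xs

    linearCombination-scale : ∀ c ts → linearCombination (map (scale c) ts) ≋ con c ⊗ linearCombination ts
    linearCombination-scale c []             = ≋-sym (⊗-zeroʳ (con c))
    linearCombination-scale c ((d , xs) ∷ ts) = ≋-trans
      (⊕-cong (≋-trans (⊗-congʳ (con-* c d)) (⊗-assoc _ _ _)) (linearCombination-scale c ts))
      (≋-sym (⊗-distribˡ _ _ _))

  degree-resp : ∀ {d p q} → p ≋ q → DegreeAtMost d p → DegreeAtMost d q
  degree-resp p≋q (ts , ≤d , p≋ts) = ts , ≤d , ≋-trans (≋-sym p≋q) p≋ts

  degree-⊕ : ∀ {d p q} → DegreeAtMost d p → DegreeAtMost d q → DegreeAtMost d (p ⊕ q)
  degree-⊕ (ts , ts≤d , p≋ts) (us , us≤d , q≋us) =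
    ts ++ us , All.++⁺ ts≤d us≤d , ≋-trans (⊕-cong p≋ts q≋us) (≋-sym (linearCombination-++ ts us))

  degree-scale : ∀ {d p} c → DegreeAtMost d p → DegreeAtMost d (con c ⊗ p)
  degree-scale {d} c (ts , ts≤d , p≋ts) =
    map (scale c) ts , All.map⁺ ts≤d , ≋-trans (⊗-congˡ p≋ts) (≋-sym (linearCombination-scale c ts))

  degree-⊝ : ∀ {d p} → DegreeAtMost d p → DegreeAtMost d (⊝ p)
  degree-⊝ {p = p} p≤d = degree-resp
    (≋-trans (⊗-congʳ (con-neg 1#)) (PolyRingProperties.-1*x≈-x p)) (degree-scale (- 1#) p≤d)

  degree-con : ∀ {d} c → DegreeAtMost d (con c)
  degree-con c = (c , []) ∷ [] , ℕ.z≤n ∷ [] ,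
    ≋-sym (≋-trans (⊕-identityʳ _) (≋-trans (⊗-comm _ _) (⊗-identityˡ _)))

  degree-var : ∀ {d} a → DegreeAtMost (suc d) (var a)
  degree-var a = (1# , a ∷ []) ∷ [] , ℕ.s≤s ℕ.z≤n ∷ [] ,
    ≋-sym (≋-trans (⊕-identityʳ _) (≋-trans (⊗-identityˡ _) (≋-trans (⊗-comm _ _) (⊗-identityˡ _))))

  degree-sum : ∀ {d n} {f : Fin n → Poly} → (∀ i → DegreeAtMost d (f i)) → DegreeAtMost d (P.sum f)
  degree-sum {n = zero}  f≤d = degree-con 0#
  degree-sum {n = suc n} f≤d = degree-⊕ (f≤d zero) (degree-sum (f≤d ∘ suc))

  PreservesConvexCombinations : (Point → Carrier) → Set
  PreservesConvexCombinations F = ∀ {r} (w : Fin r → Carrier) (p : Fin r → Point) → sum w ≈ 1# →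
    F (λ a → sum λ i → w i * p i a) ≈ sum λ i → w i * F (p i)

  -- With respect to the maximum norm, as in `closure`. The bound is one-sided because exchanging
  -- `x` and `y` gives the other side.
  Lipschitz : (Point → Carrier) → Set
  Lipschitz F = ∃[ L ] (0# ≤ L × (∀ ε x y → (∀ a → x a - y a ≤ ε) → (∀ a → y a - x a ≤ ε) → F x - F y ≤ L * ε))

  private
    -- The degree bound leaves terms with at most one variable, so a property of affine functions is
    -- checked on constants, on multiples of a coordinate and on sums.
    degree-1-induction : (T : (Point → Carrier) → Set) →
      (∀ {F G} → (∀ x → F x ≈ G x) → T F → T G) →
      (∀ c → T (λ _ → c)) → (∀ c a → T (λ x → c * x a)) → (∀ {F G} → T F → T G → T (λ x → F x + G x)) →
      ∀ {f} → DegreeAtMost 1 f → T (λ x → eval x f)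
    degree-1-induction T ext constant linear add (ts , ts≤1 , f≋ts) =
      ext (λ x → eval-cong x (≋-sym f≋ts)) (go ts ts≤1)
      where
      go : ∀ ts → All _ ts → T (λ x → eval x (linearCombination ts))
      go []                 []       = constant 0#
      go ((c , []) ∷ ts)     (_ ∷ ts≤1) = add (ext (λ x → sym (*-identityʳ c)) (constant c)) (go ts ts≤1)
      go ((c , a ∷ []) ∷ ts) (_ ∷ ts≤1) = add (ext (λ x → *-congˡ (sym (*-identityʳ (x a)))) (linear c a)) (go ts ts≤1)
      go ((c , a ∷ b ∷ _) ∷ ts) (ℕ.s≤s () ∷ ts≤1)

  degree-1⇒convex : ∀ {f} → DegreeAtMost 1 f → PreservesConvexCombinations (λ x → eval x f)
  degree-1⇒convex = degree-1-induction PreservesConvexCombinations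
    (λ F≈G conv-F w p ∑w≈1 → trans (sym (F≈G _)) (trans (conv-F w p ∑w≈1) (sum-cong-≋ λ i → *-congˡ (F≈G (p i)))))
    (λ c w p ∑w≈1 → begin-equality
      c                     ≈⟨ *-identityˡ c ⟨
      1# * c                ≈⟨ *-congʳ ∑w≈1 ⟨
      sum w * c             ≈⟨ *-distribʳ-sum c w ⟩
      sum (λ i → w i * c)   ∎)
    (λ c a w p ∑w≈1 → trans (*-distribˡ-sum c (λ i → w i * p i a))
      (sum-cong-≋ λ i → solve 3 (λ c w p → c :* (w :* p) := w :* (c :* p)) refl c (w i) (p i a)))
    (λ {F} {G} conv-F conv-G w p ∑w≈1 → begin-equality
      F _ + G _
        ≈⟨ +-cong (conv-F w p ∑w≈1) (conv-G w p ∑w≈1) ⟩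
      sum (λ i → w i * F (p i)) + sum (λ i → w i * G (p i))
        ≈⟨ ∑-distrib-+ (λ i → w i * F (p i)) (λ i → w i * G (p i)) ⟨
      sum (λ i → w i * F (p i) + w i * G (p i))
        ≈⟨ sum-cong-≋ (λ i → distribˡ (w i) (F (p i)) (G (p i))) ⟨
      sum (λ i → w i * (F (p i) + G (p i))) ∎)

  degree-1⇒Lipschitz : ∀ {f} → DegreeAtMost 1 f → Lipschitz (λ x → eval x f)
  degree-1⇒Lipschitz = degree-1-induction Lipschitz
    (λ F≈G (L , 0≤L , lip) → L , 0≤L , λ ε x y x-y≤ε y-x≤ε →
      ≤-trans (≤-reflexive (+-cong (sym (F≈G x)) (-‿cong (sym (F≈G y))))) (lip ε x y x-y≤ε y-x≤ε))
    (λ c → 0# , ≤-refl , λ ε x y _ _ → ≤-reflexive (trans (-‿inverseʳ c) (sym (zeroˡ ε))))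
    linear
    (λ {F} {G} (L , 0≤L , lip-F) (M , 0≤M , lip-G) → L + M , +-nonNegative 0≤L 0≤M , λ ε x y x-y≤ε y-x≤ε → begin
      (F x + G x) - (F y + G y)  ≈⟨ solve 4 (λ a b c d → (a :+ b) :- (c :+ d) := (a :- c) :+ (b :- d)) refl (F x) (G x) (F y) (G y) ⟩
      (F x - F y) + (G x - G y)  ≤⟨ +-mono-≤ (lip-F ε x y x-y≤ε y-x≤ε) (lip-G ε x y x-y≤ε y-x≤ε) ⟩
      L * ε + M * ε              ≈⟨ distribʳ ε L M ⟨
      (L + M) * ε                ∎)
    where
    linear : ∀ c a → Lipschitz (λ x → c * x a)
    linear c a with total 0# c
    ... | inj₁ 0≤c = c , 0≤c , λ ε x y x-y≤ε _ → begin
      c * x a - c * y a  ≈⟨ solve 3 (λ c x y → c :* x :- c :* y := c :* (x :- y)) refl c (x a) (y a) ⟩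
      c * (x a - y a)    ≤⟨ *-monoʳ-≤ 0≤c (x-y≤ε a) ⟩
      c * ε              ∎
    ... | inj₂ c≤0 = - c , 0≤-c , λ ε x y _ y-x≤ε → begin
      c * x a - c * y a  ≈⟨ solve 3 (λ c x y → c :* x :- c :* y := :- c :* (y :- x)) refl c (x a) (y a) ⟩
      - c * (y a - x a)  ≤⟨ *-monoʳ-≤ 0≤-c (y-x≤ε a) ⟩
      - c * ε            ∎
      where
      0≤-c : 0# ≤ - c
      0≤-c = ≤-trans (≤-reflexive (sym -0#≈0#)) (neg-mono-≤ c≤0)

  conv-mono : ∀ {S T : Pred Point 0ℓ} → S ⊆ T → conv S ⊆ conv T
  conv-mono S⊆T (r , w , p , 0≤w , ∑w≈1 , p∈S , x≈) = r , w , p , 0≤w , ∑w≈1 , (λ i → S⊆T (p∈S i)) , x≈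

  -- If all generators vanished at `a`, so would every weighted sum of them. This is what turns a
  -- positive entry of the uniform matrix into an automorphism.
  conv-support : ∀ {S : Pred Point 0ℓ} {x} → x ∈ conv S → ∀ {a} → ¬ (x a ≈ 0#) →
    ∃[ p ] (p ∈ S × ¬ (p a ≈ 0#))
  conv-support (r , w , p , 0≤w , ∑w≈1 , p∈S , x≈) {a} xa≉0
    with i , wp≉0 ← sum≉0⇒∃≉0 (λ ∑≈0 → xa≉0 (trans (x≈ a) ∑≈0)) =
    p i , p∈S i , λ pa≈0 → wp≉0 (trans (*-congˡ pa≈0) (zeroʳ (w i)))

  -- Nonnegative summands cannot cancel, so any generator that occurs with nonzero weight vanishes
  -- wherever `x` does.
  support-of-generator : ∀ {S : Pred Point 0ℓ} → (∀ {p} → p ∈ S → ∀ a → 0# ≤ p a) → ∀ {x} → x ∈ conv S →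
    ∃[ p ] (p ∈ S × (∀ a → x a ≈ 0# → p a ≈ 0#))
  support-of-generator 0≤S {x} (r , w , p , 0≤w , ∑w≈1 , p∈S , x≈)
    with i , wᵢ≉0 ← sum≉0⇒∃≉0 (λ ∑w≈0 → 0≉1 (trans (sym ∑w≈0) ∑w≈1)) =
    p i , p∈S i , λ a xa≈0 → *-cancelˡ-0 wᵢ≉0
      (sum≈0⇒≈0 {f = λ l → w l * p l a} (λ l → *-nonNegative (0≤w l) (0≤S (p∈S l) a)) (trans (sym (x≈ a)) xa≈0) i)

  ⊆closure : ∀ {S : Pred Point 0ℓ} → S ⊆ closure S
  ⊆closure {S} {x} x∈S ε 0<ε = x , x∈S , λ a → x-x<ε a , x-x<ε a
    where
    x-x<ε : ∀ a → x a - x a < ε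
    x-x<ε a = begin-strict
      x a - x a  ≈⟨ -‿inverseʳ (x a) ⟩
      0#         <⟨ 0<ε ⟩
      ε          ∎

  -- If f(x) = -gap < 0, points closer to x than gap/(L + 1) still have f < 0.
  closed-halfspace : ∀ {f} → DegreeAtMost 1 f → ∀ {S : Pred Point 0ℓ} → (∀ {y} → y ∈ S → 0# ≤ eval y f) →
    ∀ {x} → x ∈ closure S → 0# ≤ eval x f
  closed-halfspace {f} f≤1 0≤f {x} x∈ with 0# ≤? eval x f
  ... | yes 0≤fx = 0≤fx
  ... | no  0≰fx with degree-1⇒Lipschitz f≤1
  ...   | L , 0≤L , lip with positive-inverse (0<-resp-≤ 0<1 (≤-trans (≤-reflexive (sym (+-identityʳ 1#))) (+-monoʳ-≤ 1# 0≤L)))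
  ...     | M , 0<M , [1+L]M≈1 with x∈ (M * (0# - eval x f)) (*-positive 0<M (≰⇒0<- 0≰fx))
  ...       | y , y∈S , near = contradiction (begin
    M * gap                        ≈⟨ solve 3 (λ m l d → m :* d := (m :+ l :* m) :* d :- l :* (m :* d)) refl M L gap ⟩
    (M + L * M) * gap - L * (M * gap)
      ≈⟨ +-congʳ (trans (*-congʳ (trans (trans (+-congʳ (sym (*-identityˡ M))) (sym (distribʳ M 1# L))) [1+L]M≈1)) (*-identityˡ gap)) ⟩
    gap - L * (M * gap)              ≤⟨ +-monoʳ-≤ gap (neg-mono-≤ (lip (M * gap) y x (λ a → proj₁ (proj₂ (near a))) (λ a → proj₁ (proj₁ (near a))))) ⟩
    gap - (eval y f - eval x f)    ≈⟨ solve 2 (λ u v → (con (+ 0) :- v) :- (u :- v) := :- u) refl (eval y f) (eval x f) ⟩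
    - eval y f                   ≤⟨ neg-mono-≤ (0≤f y∈S) ⟩
    - 0#                         ≈⟨ -0#≈0# ⟩
    0#                           ∎) (0<⇒≰0 (*-positive 0<M (≰⇒0<- 0≰fx)))
    where
    gap : Carrier
    gap = 0# - eval x f

  -- On the zero set a tested polynomial equals a sum of squares; being affine, it stays nonnegative
  -- under convex combinations and under limits.
  closure-conv-zeroSet⊆TH : ∀ k (I : Pred Poly 0ℓ) → closure (conv (zeroSet I)) ⊆ TH k I
  closure-conv-zeroSet⊆TH k I {x} x∈ f f≤1 (r , h , _ , f-∑h²∈I) = closed-halfspace f≤1 on-conv x∈
    where
    on-zeroSet : ∀ {y} → y ∈ zeroSet I → 0# ≤ eval y f
    on-zeroSet {y} y∈V = begin
      0#                                     ≤⟨ sum-nonNegative (λ i → square-nonNegative (eval y (h i))) ⟩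
      sum (λ i → eval y (h i) * eval y (h i)) ≈⟨ eval-sum y (λ i → h i ⊗ h i) ⟨
      eval y (P.sum λ i → h i ⊗ h i)         ≈⟨ x∙y⁻¹≈ε⇒x≈y _ _ (y∈V f-∑h²∈I) ⟨
      eval y f                               ∎

    on-conv : ∀ {y} → y ∈ conv (zeroSet I) → 0# ≤ eval y f
    on-conv {y} (r , w , p , 0≤w , ∑w≈1 , p∈V , y≈) = begin
      0#                             ≤⟨ sum-nonNegative (λ i → *-nonNegative (0≤w i) (on-zeroSet (p∈V i))) ⟩
      sum (λ i → w i * eval (p i) f) ≈⟨ degree-1⇒convex f≤1 w p ∑w≈1 ⟨
      eval (λ a → sum λ i → w i * p i a) f ≈⟨ eval-congˡ y≈ f ⟨
      eval y f                       ∎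

  module _ {S : Pred Poly 0ℓ} {k : ℕ} {x : Point} (x∈TH : x ∈ TH k Ideal⟨ S ⟩) where

    private
      mem⇒sos : ∀ {f} → Ideal⟨ S ⟩ f → SosMod k Ideal⟨ S ⟩ f
      mem⇒sos {f} f∈I = 0 , (λ ()) , (λ ()) , resp-mem
        (P.solve 1 (λ f → f P.:= f P.:- P.con (+ 0)) ≋-refl f) f∈I

    -- A member of the ideal is congruent to the empty sum of squares, and so is its negative; the
    -- theta body thus imposes both inequalities.
    TH-zero : ∀ {f} → DegreeAtMost 1 f → Ideal⟨ S ⟩ f → eval x f ≈ 0#
    TH-zero {f} f≤1 f∈I = antisym
      (begin
        eval x f      ≈⟨ -‿involutive _ ⟨
        - - eval x f  ≤⟨ neg-mono-≤ (x∈TH (⊝ f) (degree-⊝ f≤1) (mem⇒sos (neg-mem f∈I))) ⟩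
        - 0#          ≈⟨ -0#≈0# ⟩
        0#            ∎)
      (x∈TH f f≤1 (mem⇒sos f∈I))

  -- Modulo the ideal the variable is its own square. This is the one place where a nonempty sum of
  -- squares is used as a test.
  TH-boolean⇒nonNegative : ∀ {S x a} → S (var a ⊗ var a ⊖ var a) → x ∈ TH 1 Ideal⟨ S ⟩ → 0# ≤ x a
  TH-boolean⇒nonNegative {a = a} b∈S x∈TH = x∈TH (var a) (degree-var a)
    (1 , (λ _ → var a) , (λ _ → degree-var a) , resp-mem
      (P.solve 1 (λ a → P.:- (a P.:* a P.:- a) P.:= a P.:- (a P.:* a P.:+ P.con (+ 0))) ≋-refl (var a))
      (neg-mem (generator b∈S)))

-- Polytope, integral points and theta body of a single graph

module GraphPolytopes (ℝ : RealNumbers) {n : ℕ} (G : Graph n) where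
  open OrderedField ℝ
  open ≤-Reasoning
  open Over ℝ
  open Polynomials commutativeRing (Fin n × Fin n)
  open PolynomialTools ℝ (Fin n × Fin n)
  open ThetaBody ℝ (Fin n × Fin n)
  open MatrixOver commutativeRing
  private
    module Mₚ = MatrixOver polyRing

    A : Matrix Carrier n
    A = adjacency G

    I : Pred Poly 0ℓ
    I = graphIdeal G

  automorphismMatrix : G ≅ G → Matrix Carrier n
  automorphismMatrix (φ , _) (i , j) = δ (Inverse.to φ i) j

  AutomorphismMatrix : Pred (Matrix Carrier n) 0ℓ
  AutomorphismMatrix P = ∃[ φ ] ∀ a → P a ≈ automorphismMatrix φ a

  ZeroOne : Pred (Matrix Carrier n) 0ℓ
  ZeroOne P = ∀ a → P a ≈ 0# ⊎ P a ≈ 1#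

  private
    δ-inverse : ∀ (φ : Fin n ↔ Fin n) i j → δ (Inverse.to φ i) j ≈ δ (Inverse.from φ j) i
    δ-inverse φ i j with Inverse.to φ i Fin.≟ j
    ... | yes ≡.refl = trans (δ-refl _)
      (sym (trans (reflexive (≡.cong (λ k → δ k i) (Inverse.strictlyInverseʳ φ i))) (δ-refl i)))
    ... | no  φi≢j   = trans (δ-≢ φi≢j) (sym (δ-≢ λ { ≡.refl → φi≢j (Inverse.strictlyInverseˡ φ j) }))

    δ-0∨1 : ∀ (i j : Fin n) → δ i j ≈ 0# ⊎ δ i j ≈ 1#
    δ-0∨1 i j with i Fin.≟ j
    ... | yes ≡.refl = inj₂ (δ-refl i)
    ... | no  i≢j    = inj₁ (δ-≢ i≢j)

  automorphism⇒0∨1 : AutomorphismMatrix ⊆ ZeroOne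
  automorphism⇒0∨1 {P} (φ , P≈) (i , j) with δ-0∨1 (Inverse.to (proj₁ φ) i) j
  ... | inj₁ δ≈0 = inj₁ (trans (P≈ _) δ≈0)
  ... | inj₂ δ≈1 = inj₂ (trans (P≈ _) δ≈1)

  private
    0∨1⇒nonNegative : ∀ {x} → x ≈ 0# ⊎ x ≈ 1# → 0# ≤ x
    0∨1⇒nonNegative (inj₁ x≈0) = ≤-reflexive (sym x≈0)
    0∨1⇒nonNegative (inj₂ x≈1) = ≤-trans 0≤1 (≤-reflexive (sym x≈1))

    sum-δ : ∀ (i : Fin n) → sum (δ i) ≈ 1#
    sum-δ i = trans (sum-single (δ i) i λ j → δ-≢) (δ-refl i)

  automorphism⇒polytope : AutomorphismMatrix ⊆ P-polytope G
  automorphism⇒polytope {P} Φ@((φ , pres) , P≈) = commutes , columns , rows , λ a → 0∨1⇒nonNegative (automorphism⇒0∨1 Φ a)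
    where
    φ⁻¹ : Fin n → Fin n
    φ⁻¹ = Inverse.from φ

    commutes : ∀ a → (P *ᴹ A) a ≈ (A *ᴹ P) a
    commutes (i , j) = begin-equality
      sum (λ k → P (i , k) * A (k , j))                  ≈⟨ sum-cong-≋ (λ k → *-congʳ (P≈ (i , k))) ⟩
      sum (λ k → δ (Inverse.to φ i) k * A (k , j))       ≈⟨ sum-δˡ _ (λ k → A (k , j)) ⟩
      A (Inverse.to φ i , j)
        ≡⟨ ≡.cong (λ j → A (Inverse.to φ i , j)) (Inverse.strictlyInverseˡ φ j) ⟨
      A (Inverse.to φ i , Inverse.to φ (φ⁻¹ j))          ≡⟨ ≡.cong indicator (pres i (φ⁻¹ j)) ⟩
      A (i , φ⁻¹ j)                                      ≈⟨ sum-δˡ _ (λ k → A (i , k)) ⟨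
      sum (λ k → δ (φ⁻¹ j) k * A (i , k))
        ≈⟨ sum-cong-≋ (λ k → trans (*-comm _ _) (*-congˡ (trans (sym (δ-inverse φ k j)) (sym (P≈ (k , j)))))) ⟩
      sum (λ k → A (i , k) * P (k , j))                  ∎

    rows : ∀ i → rowSum P i ≈ 1#
    rows i = trans (sum-cong-≋ λ j → P≈ (i , j)) (sum-δ _)

    columns : ∀ j → columnSum P j ≈ 1#
    columns j = trans (sum-cong-≋ λ i → trans (P≈ (i , j)) (δ-inverse φ i j)) (sum-δ _)

  automorphism⇒integral : AutomorphismMatrix ⊆ Integral
  automorphism⇒integral {P} Φ a with automorphism⇒0∨1 Φ a
  ... | inj₁ P≈0 = + 0 , P≈0
  ... | inj₂ P≈1 = + 1 , trans P≈1 (sym (+-identityʳ 1#))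

  row-unique : ∀ {P} → P ∈ P-polytope G → ∀ {i j k} → P (i , j) ≈ 1# → P (i , k) ≈ 1# → j ≡ k
  row-unique {P} (_ , _ , rows , 0≤P) {i} {j} {k} Pij≈1 Pik≈1 with j Fin.≟ k
  ... | yes j≡k = j≡k
  ... | no  j≢k = contradiction (0≤y-x⇒x≤y {1#} {0#} (begin
      0#                    ≤⟨ x≤y⇒0≤y-x (two-terms≤sum (λ l → 0≤P (i , l)) j≢k) ⟩
      rowSum P i - (P (i , j) + P (i , k))  ≈⟨ +-cong (rows i) (-‿cong (+-cong Pij≈1 Pik≈1)) ⟩
      1# - (1# + 1#)        ≈⟨ solve 1 (λ a → a :- (a :+ a) := con (+ 0) :- a) refl 1# ⟩
      0# - 1#               ∎)) (0<⇒≰0 0<1)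

  column-unique : ∀ {P} → P ∈ P-polytope G → ∀ {i k j} → P (i , j) ≈ 1# → P (k , j) ≈ 1# → i ≡ k
  column-unique {P} (_ , columns , _ , 0≤P) {i} {k} {j} Pij≈1 Pkj≈1 with i Fin.≟ k
  ... | yes i≡k = i≡k
  ... | no  i≢k = contradiction (0≤y-x⇒x≤y {1#} {0#} (begin
      0#                    ≤⟨ x≤y⇒0≤y-x (two-terms≤sum (λ l → 0≤P (l , j)) i≢k) ⟩
      columnSum P j - (P (i , j) + P (k , j))  ≈⟨ +-cong (columns j) (-‿cong (+-cong Pij≈1 Pkj≈1)) ⟩
      1# - (1# + 1#)        ≈⟨ solve 1 (λ a → a :- (a :+ a) := con (+ 0) :- a) refl 1# ⟩
      0# - 1#               ∎)) (0<⇒≰0 0<1)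

  -- Each row and each column contains exactly one 1; reading it off by rows gives `φ`, by columns
  -- its inverse `ψ`. The entry `(u , φ v)` of `P A = A P` then says that `φ` preserves adjacency.
  0∨1⇒automorphism : ∀ {P} → P ∈ P-polytope G → ZeroOne P → AutomorphismMatrix P
  0∨1⇒automorphism {P} P∈@(commutes , columns , rows , 0≤P) P01 = (mk↔ₛ′ φ ψ φψ ψφ , pres) , λ (i , j) → P≈ i j
    where
    one : ∀ {f : Fin n → Carrier} → (∀ j → f j ≈ 0# ⊎ f j ≈ 1#) → sum f ≈ 1# → ∃[ j ] f j ≈ 1#
    one f01 ∑f≈1 with sum≉0⇒∃≉0 (λ ∑f≈0 → 0≉1 (trans (sym ∑f≈0) ∑f≈1))
    ... | j , fj≉0 with f01 j
    ...   | inj₁ fj≈0 = contradiction fj≈0 fj≉0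
    ...   | inj₂ fj≈1 = j , fj≈1

    φ ψ : Fin n → Fin n
    φ i = proj₁ (one (λ j → P01 (i , j)) (rows i))
    ψ j = proj₁ (one (λ i → P01 (i , j)) (columns j))

    Pφ : ∀ i → P (i , φ i) ≈ 1#
    Pφ i = proj₂ (one (λ j → P01 (i , j)) (rows i))

    Pψ : ∀ j → P (ψ j , j) ≈ 1#
    Pψ j = proj₂ (one (λ i → P01 (i , j)) (columns j))

    φψ : ∀ j → φ (ψ j) ≡ j
    φψ j = row-unique P∈ (Pφ (ψ j)) (Pψ j)

    ψφ : ∀ i → ψ (φ i) ≡ i
    ψφ i = column-unique P∈ (Pψ (φ i)) (Pφ i)

    P≈ : ∀ i j → P (i , j) ≈ δ (φ i) j
    P≈ i j with φ i Fin.≟ j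
    ... | yes ≡.refl = trans (Pφ i) (sym (δ-refl (φ i)))
    ... | no  φi≢j with P01 (i , j)
    ...   | inj₁ Pij≈0 = trans Pij≈0 (sym (δ-≢ φi≢j))
    ...   | inj₂ Pij≈1 = contradiction (row-unique P∈ (Pφ i) Pij≈1) φi≢j

    pres : ∀ u v → adj G (φ u) (φ v) ≡ adj G u v
    pres u v = indicator-injective 0≉1 (begin-equality
      A (φ u , φ v)                                ≈⟨ sum-δˡ (φ u) (λ k → A (k , φ v)) ⟨
      sum (λ k → δ (φ u) k * A (k , φ v))          ≈⟨ sum-cong-≋ (λ k → *-congʳ (P≈ u k)) ⟨
      sum (λ k → P (u , k) * A (k , φ v))          ≈⟨ commutes (u , φ v) ⟩
      sum (λ k → A (u , k) * P (k , φ v))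
        ≈⟨ sum-single _ v (λ k v≢k → trans (*-congˡ (trans (P≈ k (φ v)) (δ-≢ λ φk≡φv →
             v≢k (≡.trans (≡.sym (ψφ v)) (≡.trans (≡.cong ψ (≡.sym φk≡φv)) (ψφ k)))))) (zeroʳ _)) ⟩
      A (u , v) * P (v , φ v)                      ≈⟨ *-congˡ (Pφ v) ⟩
      A (u , v) * 1#                               ≈⟨ *-identityʳ _ ⟩
      A (u , v)                                    ∎)

  entry≤1 : ∀ {P} → P ∈ P-polytope G → ∀ a → P a ≤ 1#
  entry≤1 (_ , _ , rows , 0≤P) (i , j) = ≤-trans (term≤sum (λ j → 0≤P (i , j)) j) (≤-reflexive (rows i))

  -- The entries of a doubly stochastic matrix lie between 0 and 1, where the only integers are 0
  -- and 1.
  integral⇒automorphism : P-polytope G ∩ Integral ⊆ AutomorphismMatrix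
  integral⇒automorphism {P} (P∈@(_ , _ , _ , 0≤P) , int) = 0∨1⇒automorphism P∈ P01
    where
    natural-nonNegative : ∀ m → 0# ≤ ℤ⟦ + m ⟧
    natural-nonNegative zero    = ≤-refl
    natural-nonNegative (suc m) = +-nonNegative 0≤1 (natural-nonNegative m)

    bounded : ∀ {x} z → x ≈ ℤ⟦ z ⟧ → 0# ≤ x → x ≤ 1# → x ≈ 0# ⊎ x ≈ 1#
    bounded (+ 0) x≈ _ _ = inj₁ x≈
    bounded (+ 1) x≈ _ _ = inj₂ (trans x≈ (+-identityʳ 1#))
    bounded {x} (+ suc (suc m)) x≈ _ x≤1 = contradiction (0≤y-x⇒x≤y {1# + ℤ⟦ + m ⟧} {0#} (begin
      0#                           ≤⟨ x≤y⇒0≤y-x x≤1 ⟩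
      1# - x                       ≈⟨ +-congˡ (-‿cong x≈) ⟩
      1# - (1# + (1# + ℤ⟦ + m ⟧))
        ≈⟨ solve 2 (λ a b → a :- (a :+ (a :+ b)) := con (+ 0) :- (a :+ b)) refl 1# _ ⟩
      0# - (1# + ℤ⟦ + m ⟧)         ∎)) (0<⇒≰0 (+-mono-<-≤ 0<1 (natural-nonNegative m)))
    bounded {x} -[1+ m ] x≈ 0≤x _ = contradiction (0≤y-x⇒x≤y {ℤ⟦ + suc m ⟧} {0#} (begin
      0#                   ≤⟨ 0≤x ⟩
      x                    ≈⟨ x≈ ⟩
      - ℤ⟦ + suc m ⟧       ≈⟨ +-identityˡ _ ⟨
      0# - ℤ⟦ + suc m ⟧    ∎)) (0<⇒≰0 (+-mono-<-≤ 0<1 (natural-nonNegative m)))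

    fromℤ≈ : ∀ z → fromℤ z ≈ ℤ⟦ z ⟧
    fromℤ≈ (+ n)    = refl
    fromℤ≈ -[1+ n ] = refl

    P01 : ZeroOne P
    P01 a with int a
    ... | z , Pa≈z = bounded z (trans Pa≈z (fromℤ≈ z)) (0≤P a) (entry≤1 P∈ a)

  private
    commuteₚ booleanₚ : Fin n × Fin n → Poly
    commuteₚ a = (indeterminate G Mₚ.*ᴹ Mₚ.adjacency G) a ⊖ (Mₚ.adjacency G Mₚ.*ᴹ indeterminate G) a
    booleanₚ a = var a ⊗ var a ⊖ var a

    columnₚ rowₚ : Fin n → Poly
    columnₚ j = Mₚ.columnSum (indeterminate G) j ⊖ con 1#
    rowₚ i    = Mₚ.rowSum (indeterminate G) i ⊖ con 1#

    eval-if : ∀ x b → eval x (if b then con 1# else con 0#) ≈ indicator b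
    eval-if x true  = refl
    eval-if x false = refl

    eval-commute : ∀ x a → eval x (commuteₚ a) ≈ (x *ᴹ A) a - (A *ᴹ x) a
    eval-commute x (i , j) = +-cong
      (trans (eval-sum x (λ k → var (i , k) ⊗ Mₚ.adjacency G (k , j))) (sum-cong-≋ λ k → *-congˡ (eval-if x (adj G k j))))
      (-‿cong (trans (eval-sum x (λ k → Mₚ.adjacency G (i , k) ⊗ var (k , j)))
                     (sum-cong-≋ λ k → *-congʳ (eval-if x (adj G i k)))))

    eval-column : ∀ x j → eval x (columnₚ j) ≈ columnSum x j - 1#
    eval-column x j = +-congʳ (eval-sum x (λ i → var (i , j)))

    eval-row : ∀ x i → eval x (rowₚ i) ≈ rowSum x i - 1#
    eval-row x i = +-congʳ (eval-sum x (λ j → var (i , j)))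

    root : ∀ {a b c} → a ≈ b - c → a ≈ 0# → b ≈ c
    root a≈b-c a≈0 = x∙y⁻¹≈ε⇒x≈y _ _ (trans (sym a≈b-c) a≈0)

    ≈⇒-≈0 : ∀ {a b} → a ≈ b → a - b ≈ 0#
    ≈⇒-≈0 {a} {b} a≈b = trans (+-congʳ a≈b) (-‿inverseʳ b)

  zeroSet⇒polytope : zeroSet I ⊆ P-polytope G
  zeroSet⇒polytope {x} x∈V =
      (λ a → root (eval-commute x a) (x∈V (generator (commute a))))
    , (λ j → root (eval-column x j) (x∈V (generator (column j))))
    , (λ i → root (eval-row x i) (x∈V (generator (row i))))
    , (λ a → 0∨1⇒nonNegative (idempotent⇒0∨1 (x∈V (generator (boolean a)))))

  zeroSet⇒automorphism : zeroSet I ⊆ AutomorphismMatrix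
  zeroSet⇒automorphism {x} x∈V = 0∨1⇒automorphism {x} (zeroSet⇒polytope {x} x∈V)
    λ a → idempotent⇒0∨1 (x∈V (generator (boolean a)))

  automorphism⇒zeroSet : AutomorphismMatrix ⊆ zeroSet I
  automorphism⇒zeroSet {x} Φ = vanishes⇒zeroSet {x = x} vanishes
    where
    x∈P : x ∈ P-polytope G
    x∈P = automorphism⇒polytope Φ

    vanishes : Vanishes (Generator G) x
    vanishes (commute a) = trans (eval-commute x a) (≈⇒-≈0 (proj₁ x∈P a))
    vanishes (column j)  = trans (eval-column x j) (≈⇒-≈0 (proj₁ (proj₂ x∈P) j))
    vanishes (row i)     = trans (eval-row x i) (≈⇒-≈0 (proj₁ (proj₂ (proj₂ x∈P)) i))
    vanishes (boolean a) with automorphism⇒0∨1 {x} Φ a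
    ... | inj₁ xa≈0 = ≈⇒-≈0 (trans (*-congʳ xa≈0) (trans (zeroˡ _) (sym xa≈0)))
    ... | inj₂ xa≈1 = ≈⇒-≈0 (trans (*-congʳ xa≈1) (*-identityˡ _))

  -- The equations of the polytope are the linear generators of the ideal and therefore hold on the
  -- theta body; the inequalities come from the Boolean generators.
  TH⊆polytope : TH 1 I ⊆ P-polytope G
  TH⊆polytope {x} x∈TH =
      (λ a → root (eval-commute x a) (TH-zero {x = x} x∈TH (degree-commute a) (generator (commute a))))
    , (λ j → root (eval-column x j) (TH-zero {x = x} x∈TH
        (degree-⊕ (degree-sum λ i → degree-var (i , j)) (degree-⊝ (degree-con 1#))) (generator (column j))))
    , (λ i → root (eval-row x i) (TH-zero {x = x} x∈TH
        (degree-⊕ (degree-sum λ j → degree-var (i , j)) (degree-⊝ (degree-con 1#))) (generator (row i))))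
    , (λ a → TH-boolean⇒nonNegative {x = x} (boolean a) x∈TH)
    where
    if-con : ∀ b → (if b then con 1# else con 0#) ≋ con (indicator b)
    if-con true  = ≋-refl
    if-con false = ≋-refl

    degree-commute : ∀ a → DegreeAtMost 1 (commuteₚ a)
    degree-commute (i , j) = degree-⊕
      (degree-sum λ k → degree-resp (≋-trans (⊗-comm _ _) (⊗-congˡ (≋-sym (if-con (adj G k j)))))
        (degree-scale (indicator (adj G k j)) (degree-var (i , k))))
      (degree-⊝ (degree-sum λ k → degree-resp (⊗-congʳ (≋-sym (if-con (adj G i k))))
        (degree-scale (indicator (adj G i k)) (degree-var (k , j)))))

  private
    allZero? : ∀ {m} (f : Fin m → Carrier) → (∀ i → f i ≈ 0#) ⊎ ∃[ i ] ¬ (f i ≈ 0#)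
    allZero? f with Fin.all? (λ i → f i ≟ 0#)
    ... | yes f≈0 = inj₁ f≈0
    ... | no  f≉0 = inj₂ (Fin.¬∀⟶∃¬ _ _ (λ i → f i ≟ 0#) f≉0)

    allZero²? : (f : Fin n × Fin n → Carrier) → (∀ a → f a ≈ 0#) ⊎ ∃[ a ] ¬ (f a ≈ 0#)
    allZero²? f with Fin.all? (λ i → Fin.all? λ j → f (i , j) ≟ 0#)
    ... | yes f≈0 = inj₁ λ (i , j) → f≈0 i j
    ... | no  f≉0 with Fin.¬∀⟶∃¬ _ _ (λ i → Fin.all? λ j → f (i , j) ≟ 0#) f≉0
    ...   | i , fi≉0 with Fin.¬∀⟶∃¬ _ _ (λ j → f (i , j) ≟ 0#) fi≉0
    ...     | j , fij≉0 = inj₂ ((i , j) , fij≉0)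

    vanishes? : ∀ x → Vanishes (Generator G) x ⊎ ∃[ g ] (Generator G g × ¬ (eval x g ≈ 0#))
    vanishes? x with allZero²? (λ a → eval x (commuteₚ a)) | allZero? (λ j → eval x (columnₚ j))
                   | allZero? (λ i → eval x (rowₚ i)) | allZero²? (λ a → eval x (booleanₚ a))
    ... | inj₂ (a , g≉0) | _ | _ | _ = inj₂ (_ , commute a , g≉0)
    ... | _ | inj₂ (j , g≉0) | _ | _ = inj₂ (_ , column j , g≉0)
    ... | _ | _ | inj₂ (i , g≉0) | _ = inj₂ (_ , row i , g≉0)
    ... | _ | _ | _ | inj₂ (a , g≉0) = inj₂ (_ , boolean a , g≉0)
    ... | inj₁ c | inj₁ d | inj₁ r | inj₁ b = inj₁ λ
      { (commute a) → c a ; (column j) → d j ; (row i) → r i ; (boolean a) → b a }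

    open BooleanIdeal (Generator G) vanishes? boolean (≡-dec Fin._≟_ Fin._≟_)
      (cartesianProduct (allFin n) (allFin n)) (λ (i , j) → ∈-cartesianProduct⁺ (∈-allFin i) (∈-allFin j))

  -- If no automorphism had a nonzero entry at `a`, the variable at `a` would belong to the ideal
  -- and vanish on the theta body. This is the information that membership in the polytope does not
  -- give.
  TH-support : ∀ {x} → x ∈ TH 1 I → ∀ {a} → ¬ (x a ≈ 0#) → ∃[ p ] (AutomorphismMatrix p × ¬ (p a ≈ 0#))
  TH-support {x} x∈TH {a} xa≉0 with mem⊎nonZeroOn (var a)
  ... | inj₁ a∈I              = contradiction (TH-zero {x = x} x∈TH (degree-var a) a∈I) xa≉0
  ... | inj₂ (p , p∈V , pa≉0) = p , zeroSet⇒automorphism {p} p∈V , pa≉0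

  -- One inclusion holds for every ideal. For the other, a hull lies in its closure, so an exact
  -- convex combination settles it and no limit has to be taken.
  TH⊆conv-automorphisms⇒exact : TH 1 I ⊆ conv AutomorphismMatrix → Exact G
  TH⊆conv-automorphisms⇒exact TH⊆ = closure-conv-zeroSet⊆TH 1 I
    , λ {x} x∈TH → ⊆closure {S = conv (zeroSet I)} {x} (conv-mono (λ {p} → automorphism⇒zeroSet {p}) {x} (TH⊆ {x} x∈TH))

  compact⇒exact : Compact G → Exact G
  compact⇒exact (P⊆IP , _) = TH⊆conv-automorphisms⇒exact
    λ {x} x∈TH → conv-mono (λ {p} → integral⇒automorphism {p}) {x} (P⊆IP {x} (TH⊆polytope {x} x∈TH))

-- Matchings in the support of a nonnegative matrix

injective⇒surjective : ∀ {n} {f : Fin n → Fin n} → Injective _≡_ _≡_ f → ∀ j → ∃[ i ] f i ≡ j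
injective⇒surjective {suc n} {f} inj j with Fin.any? (λ i → f i Fin.≟ j)
... | yes i = i
... | no ¬i = contradiction (λ {x} {y} eq → inj (Fin.punchOut-injective (j≢f x) (j≢f y) eq)) (Fin.<⇒notInjective (ℕ.n<1+n n))
  where
  j≢f : ∀ x → j ≢ f x
  j≢f x j≡fx = ¬i (x , ≡.sym j≡fx)

injective⇒↔ : ∀ {n} (f : Fin n → Fin n) → Injective _≡_ _≡_ f → Fin n ↔ Fin n
injective⇒↔ f inj = mk↔ₛ′ f (λ j → proj₁ (injective⇒surjective inj j)) (λ j → proj₂ (injective⇒surjective inj j))
  λ i → inj (proj₂ (injective⇒surjective inj (f i)))

module Matching (ℝ : RealNumbers) where
  open OrderedField ℝ
  open ≤-Reasoning

  SelectsSupport : ∀ {k n} → (Fin k → Fin n → Carrier) → (Fin k → Fin n) → Set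
  SelectsSupport M f = Injective _≡_ _≡_ f × (∀ i → ¬ (M i (f i) ≈ 0#))

  -- Row 0 is added to a matching f of the other rows by the augmenting path method.  S collects the rows r for which
  -- f can be rerouted, on S only, so as to match every row except r using no new column.
  module Augment {k n} (M : Fin (suc k) → Fin n → Carrier) (s : Carrier) (0<s : 0# < s)
    (0≤M : ∀ i j → 0# ≤ M i j) (rows : ∀ i → sum (M i) ≈ s) (columns : ∀ j → sum (λ i → M i j) ≤ s)
    (f : Fin k → Fin n) (f-inj : Injective _≡_ _≡_ f) (f-supp : ∀ i → ¬ (M (suc i) (f i) ≈ 0#)) where

    record Rerouting (S : Subset.Subset (suc k)) (r : Fin (suc k)) : Set where
      field
        g         : Fin (suc k) → Fin n
        support   : ∀ i → i ≢ r → ¬ (M i (g i) ≈ 0#)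
        injective : ∀ i j → i ≢ r → j ≢ r → g i ≡ g j → i ≡ j
        agrees    : ∀ i → suc i Subset.∉ S → g (suc i) ≡ f i
        image     : ∀ i → i ≢ r → ∃[ l ] g i ≡ f l

    open Rerouting

    assign : ∀ {S r} → Rerouting S r → Fin n → Fin (suc k) → Fin n
    assign {r = r} ρ c = updateAt (g ρ) r (λ _ → c)

    module _ {S r} (ρ : Rerouting S r) (c : Fin n) where
      assign-≡ : assign ρ c r ≡ c
      assign-≡ = updateAt-updates r (g ρ)

      assign-≢ : ∀ {i} → i ≢ r → assign ρ c i ≡ g ρ i
      assign-≢ {i} i≢r = updateAt-minimal i r (g ρ) i≢r

      assign-support : ¬ (M r c ≈ 0#) → ∀ i → ¬ (M i (assign ρ c i) ≈ 0#)
      assign-support Mrc≉0 i with i Fin.≟ r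
      ... | yes ≡.refl = ≡.subst (λ j → ¬ (M r j ≈ 0#)) (≡.sym assign-≡) Mrc≉0
      ... | no  i≢r    = ≡.subst (λ j → ¬ (M i j ≈ 0#)) (≡.sym (assign-≢ i≢r)) (support ρ i i≢r)

      assign-injective : (U : Fin (suc k) → Set) → (∀ i → i ≢ r → U i → g ρ i ≢ c) →
        ∀ i j → U i → U j → assign ρ c i ≡ assign ρ c j → i ≡ j
      assign-injective U g≢c i j i∈U j∈U eq with i Fin.≟ r | j Fin.≟ r
      ... | yes ≡.refl | yes ≡.refl = ≡.refl
      ... | yes ≡.refl | no j≢r =
        contradiction (≡.trans (≡.sym (assign-≢ j≢r)) (≡.trans (≡.sym eq) assign-≡)) (g≢c j j≢r j∈U)
      ... | no i≢r | yes ≡.refl =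
        contradiction (≡.trans (≡.sym (assign-≢ i≢r)) (≡.trans eq assign-≡)) (g≢c i i≢r i∈U)
      ... | no i≢r | no j≢r = injective ρ i j i≢r j≢r (≡.trans (≡.sym (assign-≢ i≢r)) (≡.trans eq (assign-≢ j≢r)))

    -- A support entry that leads out of `S`. If `f` does not use the column `c`, the augmenting
    -- path ends there; otherwise the row holding `c` lies outside `S` and can be freed, so it joins
    -- `S`.
    Exit : Subset.Subset (suc k) → Fin (suc k) → Fin n → Set
    Exit S r c = r Subset.∈ S × ¬ (M r c ≈ 0#) × ¬ (∃[ l ] (suc l Subset.∈ S × f l ≡ c))

    exit? : ∀ S r c → Dec (Exit S r c)
    exit? S r c = (r Subset.∈? S) ×-dec ¬? (M r c ≟ 0#) ×-dec ¬? (Fin.any? λ l → (suc l Subset.∈? S) ×-dec (f l Fin.≟ c))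

    module _ (S : Subset.Subset (suc k)) (0∈S : zero Subset.∈ S) (closed : ∀ r c → ¬ Exit S r c) where

      private
        χ : Fin (suc k) → Carrier
        χ i = indicator (does (i Subset.∈? S))

        χ-∈ : ∀ {i} → i Subset.∈ S → χ i ≈ 1#
        χ-∈ {i} i∈S rewrite dec-true (i Subset.∈? S) i∈S = refl

        χ-nonNegative : ∀ i → 0# ≤ χ i
        χ-nonNegative i with does (i Subset.∈? S)
        ... | true  = 0≤1
        ... | false = ≤-refl

        T : Carrier
        T = sum λ l → χ (suc l) * s

        summand-nonNegative : ∀ r l → 0# ≤ χ (suc l) * M r (f l)
        summand-nonNegative r l = *-nonNegative (χ-nonNegative (suc l)) (0≤M r (f l))

        δ-nonNegative : ∀ {m} (i j : Fin m) → 0# ≤ δ i j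
        δ-nonNegative i j with i Fin.≟ j
        ... | yes ≡.refl = ≤-trans 0≤1 (≤-reflexive (sym (δ-refl i)))
        ... | no  i≢j    = ≤-reflexive (sym (δ-≢ i≢j))

        entry-bound : ∀ r → r Subset.∈ S → ∀ c → M r c ≤ sum λ l → χ (suc l) * (δ (f l) c * M r c)
        entry-bound r r∈S c with M r c ≟ 0# | Fin.any? (λ l → (suc l Subset.∈? S) ×-dec (f l Fin.≟ c))
        ... | yes Mrc≈0 | _ = ≤-trans (≤-reflexive Mrc≈0) (sum-nonNegative λ l →
          *-nonNegative (χ-nonNegative (suc l)) (*-nonNegative (δ-nonNegative (f l) c) (0≤M r c)))
        ... | no Mrc≉0 | no ¬l = contradiction (r∈S , Mrc≉0 , ¬l) (closed r c)
        ... | no _ | yes (l , l∈S , ≡.refl) = ≤-trans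
          (≤-reflexive (sym (trans (*-cong (χ-∈ l∈S) (*-congʳ (δ-refl (f l)))) (trans (*-identityˡ _) (*-identityˡ _)))))
          (term≤sum (λ l → *-nonNegative (χ-nonNegative (suc l)) (*-nonNegative (δ-nonNegative (f l) c) (0≤M r c))) l)

        row-bound : ∀ r → χ r * s ≤ sum λ l → χ (suc l) * M r (f l)
        row-bound r with r Subset.∈? S
        ... | no  _   = ≤-trans (≤-reflexive (zeroˡ s)) (sum-nonNegative (summand-nonNegative r))
        ... | yes r∈S = begin
          1# * s                                                          ≈⟨ *-identityˡ s ⟩
          s                                                               ≈⟨ rows r ⟨
          sum (M r)                                                       ≤⟨ sum-mono-≤ (entry-bound r r∈S) ⟩
          sum (λ c → sum λ l → χ (suc l) * (δ (f l) c * M r c))           ≈⟨ ∑-comm (λ c l → χ (suc l) * (δ (f l) c * M r c)) ⟩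
          sum (λ l → sum λ c → χ (suc l) * (δ (f l) c * M r c))
            ≈⟨ sum-cong-≋ (λ l → trans (sym (*-distribˡ-sum (χ (suc l)) (λ c → δ (f l) c * M r c)))
                                       (*-congˡ (sum-δˡ (f l) (M r)))) ⟩
          sum (λ l → χ (suc l) * M r (f l))                               ∎

      -- Hall's condition by counting. Without an exit, the rows in `S` have their whole mass
      -- `|S| s` in the columns held by the rows of `S` other than row 0; these have room for only
      -- `(|S| - 1) s`, which is `T`.
      closed⇒s≤0 : s ≤ 0#
      closed⇒s≤0 = begin
        s                                                   ≈⟨ solve 2 (λ s t → s := s :+ t :- t) refl s T ⟩
        s + T - T                                           ≈⟨ +-congʳ (+-congʳ (trans (*-congʳ (χ-∈ 0∈S)) (*-identityˡ s))) ⟨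
        sum (λ r → χ r * s) - T                             ≤⟨ +-mono-≤ (sum-mono-≤ row-bound) ≤-refl ⟩
        sum (λ r → sum λ l → χ (suc l) * M r (f l)) - T     ≈⟨ +-congʳ (∑-comm (λ r l → χ (suc l) * M r (f l))) ⟩
        sum (λ l → sum λ r → χ (suc l) * M r (f l)) - T
          ≈⟨ +-congʳ (sum-cong-≋ λ l → *-distribˡ-sum (χ (suc l)) (λ r → M r (f l))) ⟨
        sum (λ l → χ (suc l) * sum λ r → M r (f l)) - T
          ≤⟨ +-mono-≤ (sum-mono-≤ λ l → *-monoʳ-≤ (χ-nonNegative (suc l)) (columns (f l))) ≤-refl ⟩
        T - T                                               ≈⟨ -‿inverseʳ T ⟩
        0#                                                  ∎

    search : ∀ S → Acc Subset._⊃_ S → zero Subset.∈ S → (∀ r → r Subset.∈ S → Rerouting S r) → ∃[ h ] SelectsSupport M h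
    search S (acc larger) 0∈S reroute with Fin.any? (λ r → Fin.any? (exit? S r))
    ... | no closed = contradiction (closed⇒s≤0 S 0∈S λ r c e → closed (r , c , e)) (0<⇒≰0 0<s)
    ... | yes (r , c , r∈S , Mrc≉0 , c∉fS) with Fin.any? (λ l → f l Fin.≟ c)
    ...   | no c∉f = assign ρ c
        , (λ {i} {j} → assign-injective ρ c (λ _ → ⊤) (λ i i≢r _ gi≡c → let l , gi≡fl = image ρ i i≢r in
             c∉f (l , ≡.trans (≡.sym gi≡fl) gi≡c)) i j tt tt)
        , assign-support ρ c Mrc≉0
      where
      ρ : Rerouting S r
      ρ = reroute r r∈S
    ...   | yes (l , ≡.refl) = search S′ (larger (S⊆S′ , suc l , Subset.q⊆p∪q S _ (Subset.x∈⁅x⁆ (suc l)) , l∉S)) (S⊆S′ 0∈S) reroute′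
      where
      S′ : Subset.Subset (suc k)
      S′ = S Subset.∪ Subset.⁅ suc l ⁆

      S⊆S′ : S Subset.⊆ S′
      S⊆S′ = Subset.p⊆p∪q _

      l∉S : suc l Subset.∉ S
      l∉S l∈S = c∉fS (l , l∈S , ≡.refl)

      ρ : Rerouting S r
      ρ = reroute r r∈S

      l≢r : suc l ≢ r
      l≢r l≡r = l∉S (≡.subst (Subset._∈ S) (≡.sym l≡r) r∈S)

      reroute′ : ∀ i → i Subset.∈ S′ → Rerouting S′ i
      reroute′ i i∈S′ with Subset.x∈p∪q⁻ S _ i∈S′
      ... | inj₁ i∈S = record
        { g = g ρᵢ ; support = support ρᵢ ; injective = injective ρᵢ ; agrees = λ j j∉S′ → agrees ρᵢ j (j∉S′ ∘ S⊆S′)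
        ; image = image ρᵢ }
        where
        ρᵢ : Rerouting S i
        ρᵢ = reroute i i∈S
      ... | inj₂ i∈l with Subset.x∈⁅y⁆⇒x≡y (suc l) i∈l
      ...   | ≡.refl = record
        { g         = assign ρ (f l)
        ; support   = λ i _ → assign-support ρ (f l) Mrc≉0 i
        -- Since `ρ` agrees with `f` outside `S`, the column `f l` was held by row `suc l` alone,
        -- and that row is now the exempt one.
        ; injective = assign-injective ρ (f l) (_≢ suc l) λ i i≢r i≢l gi≡fl →
            i≢l (injective ρ i (suc l) i≢r l≢r (≡.trans gi≡fl (≡.sym (agrees ρ l l∉S))))
        ; agrees    = λ j j∉S′ → ≡.trans
            (assign-≢ ρ (f l) λ j≡r → j∉S′ (S⊆S′ (≡.subst (Subset._∈ S) (≡.sym j≡r) r∈S)))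
            (agrees ρ j (j∉S′ ∘ S⊆S′))
        ; image     = image′ }
        where
        image′ : ∀ i → i ≢ suc l → ∃[ l′ ] assign ρ (f l) i ≡ f l′
        image′ i _ with i Fin.≟ r
        ... | yes ≡.refl = l , assign-≡ ρ (f l)
        ... | no  i≢r    = let l′ , gi≡ = image ρ i i≢r in l′ , ≡.trans (assign-≢ ρ (f l) i≢r) gi≡

    augment : ∃[ h ] SelectsSupport M h
    augment = search Subset.⁅ zero ⁆ (⊃-wellFounded _) (Subset.x∈⁅x⁆ zero) λ r r∈ → unrouted r (Subset.x∈⁅y⁆⇒x≡y zero r∈)
      where
      -- An arbitrary column, which exists because row 0 has positive sum. It serves only as a
      -- default value of `g₀` at the exempt row.
      free : Fin n
      free = proj₁ (sum≉0⇒∃≉0 (λ ∑≈0 → 0<⇒≉ 0<s (trans (sym (rows zero)) ∑≈0)))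

      g₀ : Fin (suc k) → Fin n
      g₀ zero    = free
      g₀ (suc i) = f i

      unrouted : ∀ r → r ≡ zero → Rerouting Subset.⁅ zero ⁆ r
      unrouted .zero ≡.refl = record
        { g         = g₀
        ; support   = λ { zero i≢0 → contradiction ≡.refl i≢0 ; (suc i) _ → f-supp i }
        ; injective = λ { zero _ i≢0 _ _ → contradiction ≡.refl i≢0
                        ; (suc i) zero _ j≢0 _ → contradiction ≡.refl j≢0
                        ; (suc i) (suc j) _ _ eq → ≡.cong suc (f-inj eq) }
        ; agrees    = λ i _ → ≡.refl
        ; image     = λ { zero i≢0 → contradiction ≡.refl i≢0 ; (suc i) _ → i , ≡.refl } }

  -- Induction on the rows. The column sums are only bounded by `s`, not equal to it, so that the
  -- hypothesis survives the removal of a row.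
  support-selection : ∀ {k n} (M : Fin k → Fin n → Carrier) {s} → 0# < s → (∀ i j → 0# ≤ M i j) →
    (∀ i → sum (M i) ≈ s) → (∀ j → sum (λ i → M i j) ≤ s) → ∃[ f ] SelectsSupport M f
  support-selection {zero}  M 0<s 0≤M rows columns = (λ ()) , (λ { {()} }) , λ ()
  support-selection {suc k} M {s} 0<s 0≤M rows columns
    with support-selection (M ∘ suc) 0<s (0≤M ∘ suc) (rows ∘ suc) (λ j → ≤-trans
      (≤-trans (≤-reflexive (sym (+-identityˡ _))) (+-mono-≤ (0≤M zero j) ≤-refl)) (columns j))
  ... | f , f-inj , f-supp = Augment.augment M s 0<s 0≤M rows columns f f-inj f-supp

-- Greedy decomposition into automorphisms

≅-trans : ∀ {l m n} {G : Graph l} {H : Graph m} {K : Graph n} → G ≅ H → H ≅ K → G ≅ K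
≅-trans (φ , pres-φ) (ψ , pres-ψ) = ψ ↔-∘ φ , λ u v → ≡.trans (pres-ψ _ _) (pres-φ u v)

≅-refl : ∀ {n} {G : Graph n} → G ≅ G
≅-refl = ↔-id _ , λ _ _ → ≡.refl

module Decomposition (ℝ : RealNumbers) {n : ℕ} (G : Graph n) where
  open OrderedField ℝ
  open ≤-Reasoning
  open Over ℝ
  open MatrixOver commutativeRing
  open GraphPolytopes ℝ G

  private
    A : Matrix Carrier n
    A = adjacency G

  -- The polytope scaled by `s`. Remainders of the decomposition stay in such cones with decreasing
  -- `s` and never have to be normalised.
  Cone : Carrier → Pred (Matrix Carrier n) 0ℓ
  Cone s P =
      (∀ a → (P *ᴹ A) a ≈ (A *ᴹ P) a)
    × (∀ j → columnSum P j ≈ s)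
    × (∀ i → rowSum P i ≈ s)
    × (∀ a → 0# ≤ P a)

  module _ (Allowed : Fin n × Fin n → Set) where

    -- `Allowed` carries what is known about `P` beyond membership in the cone. As a condition on
    -- the support alone, it passes to every remainder.
    SupportAllowed : Pred (Matrix Carrier n) 0ℓ
    SupportAllowed P = ∀ a → ¬ (P a ≈ 0#) → Allowed a

    AutomorphismInSupport : Set
    AutomorphismInSupport = ∀ {s P} → 0# < s → P ∈ Cone s → SupportAllowed P →
      Σ[ φ ∈ G ≅ G ] (∀ i → ¬ (P (i , Inverse.to (proj₁ φ) i) ≈ 0#))

    ConicCombination : Carrier → Pred (Matrix Carrier n) 0ℓ
    ConicCombination s P = ∃[ r ] Σ[ w ∈ (Fin r → Carrier) ] Σ[ p ∈ (Fin r → Matrix Carrier n) ]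
      ( (∀ i → 0# ≤ w i) × sum w ≈ s
      × (∀ i → p i ∈ AutomorphismMatrix)
      × (∀ a → P a ≈ sum λ i → w i * p i a) )

    -- As in Birkhoff's theorem: subtract the largest possible multiple of an automorphism in the support, so that
    -- some entry becomes zero.
    module _ (vertex : Fin n) (inSupport : AutomorphismInSupport) where

      decompose : ∀ (L : List (Fin n × Fin n)) → Acc ℕ._<_ (length L) → ∀ {s P} → 0# ≤ s → P ∈ Cone s → SupportAllowed P →
        (∀ a → ¬ (P a ≈ 0#) → a ∈ᴸ L) → ConicCombination s P
      decompose L (acc shorter) {s} {P} 0≤s P∈@(commutes , columns , rows , 0≤P) allowed P⊆L with s ≟ 0#
      ... | yes s≈0 = 0 , (λ ()) , (λ ()) , (λ ()) , sym s≈0 , (λ ()) ,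
        λ (i , j) → sum≈0⇒≈0 (λ j → 0≤P (i , j)) (trans (rows i) s≈0) j
      ... | no s≉0 with inSupport (nonNegative∧≉0⇒0< 0≤s s≉0) P∈ allowed
      ...   | (φ , pres) , Pφ≉0 = subtract (minimum vertex (λ i → P (i , Inverse.to φ i)))
        where
        Φ : Matrix Carrier n
        Φ = automorphismMatrix (φ , pres)

        Φ∈ : Φ ∈ P-polytope G
        Φ∈ = automorphism⇒polytope ((φ , pres) , λ _ → refl)

        subtract : (∃[ i ] ∀ j → P (i , Inverse.to φ i) ≤ P (j , Inverse.to φ j)) → ConicCombination s P
        subtract (i₀ , least) = extend (decompose L′ (shorter L′<L) 0≤s-t P′∈ allowed′ P′⊆L′)
          where
          a₀ : Fin n × Fin n
          a₀ = i₀ , Inverse.to φ i₀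

          t : Carrier
          t = P a₀

          P′ : Matrix Carrier n
          P′ a = P a - t * Φ a

          _≟ᵃ_ : DecidableEquality (Fin n × Fin n)
          _≟ᵃ_ = ≡-dec Fin._≟_ Fin._≟_

          -- `L` only has to contain the support. The remainder vanishes at `a₀`, which therefore
          -- may be struck out; this shortens the list because `a₀` is a support entry of `P`.
          L′ : List (Fin n × Fin n)
          L′ = filter (λ a → ¬? (a₀ ≟ᵃ a)) L

          L′<L : length L′ ℕ.< length L
          L′<L = filter-notAll _ L (Any.map (λ a₀≡a a₀≢a → a₀≢a a₀≡a) (P⊆L a₀ (Pφ≉0 i₀)))

          0≤s-t : 0# ≤ s - t
          0≤s-t = x≤y⇒0≤y-x (≤-trans (term≤sum (λ j → 0≤P (i₀ , j)) (Inverse.to φ i₀)) (≤-reflexive (rows i₀)))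

          sum-linear : ∀ {m} (f g : Fin m → Carrier) → sum (λ i → f i - t * g i) ≈ sum f - t * sum g
          sum-linear f g = trans (sum-distrib-- f (λ i → t * g i)) (+-congˡ (-‿cong (sym (*-distribˡ-sum t g))))

          P′Φ : ∀ i → P′ (i , Inverse.to φ i) ≈ P (i , Inverse.to φ i) - t
          P′Φ i = +-congˡ (-‿cong (trans (*-congˡ (δ-refl _)) (*-identityʳ t)))

          P′≢ : ∀ {i j} → Inverse.to φ i ≢ j → P′ (i , j) ≈ P (i , j)
          P′≢ φi≢j = trans (+-congˡ (trans (-‿cong (trans (*-congˡ (δ-≢ φi≢j)) (zeroʳ t))) -0#≈0#)) (+-identityʳ _)

          0≤P′ : ∀ a → 0# ≤ P′ a
          0≤P′ (i , j) with Inverse.to φ i Fin.≟ j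
          ... | yes ≡.refl = ≤-trans (x≤y⇒0≤y-x (least i)) (≤-reflexive (sym (P′Φ i)))
          ... | no φi≢j    = ≤-trans (0≤P (i , j)) (≤-reflexive (sym (P′≢ φi≢j)))

          P′∈ : P′ ∈ Cone (s - t)
          P′∈ = commutes′
            , (λ j → trans (sum-linear (λ i → P (i , j)) (λ i → Φ (i , j))) (+-cong (columns j)
                (-‿cong (trans (*-congˡ (proj₁ (proj₂ Φ∈) j)) (*-identityʳ t)))))
            , (λ i → trans (sum-linear (λ j → P (i , j)) (λ j → Φ (i , j))) (+-cong (rows i)
                (-‿cong (trans (*-congˡ (proj₁ (proj₂ (proj₂ Φ∈)) i)) (*-identityʳ t)))))
            , 0≤P′
            where
            commutes′ : ∀ a → (P′ *ᴹ A) a ≈ (A *ᴹ P′) a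
            commutes′ (i , j) = begin-equality
              sum (λ k → (P (i , k) - t * Φ (i , k)) * A (k , j))
                ≈⟨ sum-cong-≋ (λ k → solve 4 (λ p t f a → (p :- t :* f) :* a := p :* a :- t :* (f :* a)) refl (P (i , k)) t (Φ (i , k)) (A (k , j))) ⟩
              sum (λ k → P (i , k) * A (k , j) - t * (Φ (i , k) * A (k , j)))
                ≈⟨ sum-linear (λ k → P (i , k) * A (k , j)) (λ k → Φ (i , k) * A (k , j)) ⟩
              (P *ᴹ A) (i , j) - t * (Φ *ᴹ A) (i , j)
                ≈⟨ +-cong (commutes (i , j)) (-‿cong (*-congˡ (proj₁ Φ∈ (i , j)))) ⟩
              (A *ᴹ P) (i , j) - t * (A *ᴹ Φ) (i , j)
                ≈⟨ sum-linear (λ k → A (i , k) * P (k , j)) (λ k → A (i , k) * Φ (k , j)) ⟨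
              sum (λ k → A (i , k) * P (k , j) - t * (A (i , k) * Φ (k , j)))
                ≈⟨ sum-cong-≋ (λ k → solve 4 (λ p t f a → a :* p :- t :* (a :* f) := a :* (p :- t :* f)) refl (P (k , j)) t (Φ (k , j)) (A (i , k))) ⟩
              sum (λ k → A (i , k) * (P (k , j) - t * Φ (k , j))) ∎

          support′ : ∀ a → ¬ (P′ a ≈ 0#) → ¬ (P a ≈ 0#)
          support′ a@(i , j) P′a≉0 Pa≈0 with Inverse.to φ i Fin.≟ j
          ... | yes ≡.refl = Pφ≉0 i Pa≈0
          ... | no φi≢j    = P′a≉0 (trans (P′≢ φi≢j) Pa≈0)

          allowed′ : SupportAllowed P′
          allowed′ a P′a≉0 = allowed a (support′ a P′a≉0)

          P′⊆L′ : ∀ a → ¬ (P′ a ≈ 0#) → a ∈ᴸ L′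
          P′⊆L′ a P′a≉0 = ∈-filter⁺ (λ a → ¬? (a₀ ≟ᵃ a)) (P⊆L a (support′ a P′a≉0))
            λ { ≡.refl → P′a≉0 (trans (P′Φ i₀) (-‿inverseʳ t)) }

          extend : ConicCombination (s - t) P′ → ConicCombination s P
          extend (r , w , p , 0≤w , ∑w≈ , p∈ , P′≈) = suc r , w′ , p′
            , (λ { zero → 0≤P a₀ ; (suc i) → 0≤w i })
            , trans (+-congˡ ∑w≈) (solve 2 (λ t s → t :+ (s :- t) := s) refl t s)
            , (λ { zero → (φ , pres) , λ _ → refl ; (suc i) → p∈ i })
            , λ a → trans (solve 2 (λ q u → q := u :+ (q :- u)) refl (P a) (t * Φ a)) (+-congˡ (P′≈ a))
            where
            w′ : Fin (suc r) → Carrier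
            w′ zero    = t
            w′ (suc i) = w i

            p′ : Fin (suc r) → Matrix Carrier n
            p′ zero    = Φ
            p′ (suc i) = p i

    supported⇒conv : AutomorphismInSupport → ∀ {P} → P ∈ P-polytope G → SupportAllowed P → P ∈ conv AutomorphismMatrix
    supported⇒conv inSupport {P} P∈ allowed with Fin.any? {n} (λ _ → yes tt)
    ... | yes (vertex , _) = decompose vertex inSupport (cartesianProduct (allFin n) (allFin n)) (<-wellFounded _) 0≤1 P∈ allowed
        λ (i , j) _ → ∈-cartesianProduct⁺ (∈-allFin i) (∈-allFin j)
    -- On the graph without vertices there is nothing to minimise over; its empty matrix is the
    -- identity automorphism, taken with weight 1.
    ... | no  ∄vertex = 1 , (λ _ → 1#) , (λ _ → P) , (λ _ → 0≤1) , +-identityʳ 1#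
        , (λ _ → ≅-refl {G = G}
               , λ (i , _) → contradiction (i , tt) ∄vertex)
        , λ (i , _) → contradiction (i , tt) ∄vertex

-- Components of a disjoint union and their isomorphisms

module DisjointUnion where

  ι : ∀ {m} (n : Fin m → ℕ) (a : Fin m) → Fin (n a) → Fin (order n)
  ι {suc m} n zero    x = x ↑ˡ order (n ∘ suc)
  ι {suc m} n (suc a) x = n zero ↑ʳ ι (n ∘ suc) a x

  ι-surjective : ∀ {m} {n : Fin m → ℕ} (u : Fin (order n)) → ∃[ a ] ∃[ x ] ι n a x ≡ u
  ι-surjective {suc m} {n} u with splitAt (n zero) u in eq
  ... | inj₁ x = zero , x , Fin.splitAt⁻¹-↑ˡ eq
  ... | inj₂ v with ι-surjective {m} {n ∘ suc} v
  ...   | a , x , ≡.refl = suc a , x , Fin.splitAt⁻¹-↑ʳ eq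

  ↑ˡ≢↑ʳ : ∀ {m n} (x : Fin m) (y : Fin n) → x ↑ˡ n ≢ m ↑ʳ y
  ↑ˡ≢↑ʳ {m} {n} x y eq with () ← ≡.trans (≡.sym (Fin.splitAt-↑ˡ m x n)) (≡.trans (≡.cong (splitAt m) eq) (Fin.splitAt-↑ʳ m n y))

  ι-injective : ∀ {m} {n : Fin m → ℕ} {a b} {x : Fin (n a)} {y : Fin (n b)} →
    ι n a x ≡ ι n b y → _≡_ {A = ∃ (Fin ∘ n)} (a , x) (b , y)
  ι-injective {suc m} {n} {zero}  {zero}  eq = ≡.cong (zero ,_) (Fin.↑ˡ-injective _ _ _ eq)
  ι-injective {suc m} {n} {zero}  {suc b} eq = contradiction eq (↑ˡ≢↑ʳ _ _)
  ι-injective {suc m} {n} {suc a} {zero}  eq = contradiction (≡.sym eq) (↑ˡ≢↑ʳ _ _)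
  ι-injective {suc m} {n} {suc a} {suc b} eq
    with ≡.refl ← ι-injective {m} {n ∘ suc} {a} {b} (Fin.↑ʳ-injective (n zero) _ _ eq) = ≡.refl

  adj-ι : ∀ {m} {n : Fin m → ℕ} (G : ∀ i → Graph (n i)) a x y → adj (⨆ G) (ι n a x) (ι n a y) ≡ adj (G a) x y
  adj-ι {suc m} {n} G zero x y
    rewrite Fin.splitAt-↑ˡ (n zero) x (order (n ∘ suc)) | Fin.splitAt-↑ˡ (n zero) y (order (n ∘ suc)) = ≡.refl
  adj-ι {suc m} {n} G (suc a) x y
    rewrite Fin.splitAt-↑ʳ (n zero) (order (n ∘ suc)) (ι (n ∘ suc) a x) | Fin.splitAt-↑ʳ (n zero) (order (n ∘ suc)) (ι (n ∘ suc) a y)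
    = adj-ι (G ∘ suc) a x y

  adj-ι-≢ : ∀ {m} {n : Fin m → ℕ} (G : ∀ i → Graph (n i)) {a b} → a ≢ b → ∀ x y → adj (⨆ G) (ι n a x) (ι n b y) ≡ false
  adj-ι-≢ {suc m} {n} G {zero}  {zero}  a≢b x y = contradiction ≡.refl a≢b
  adj-ι-≢ {suc m} {n} G {zero}  {suc b} a≢b x y
    rewrite Fin.splitAt-↑ˡ (n zero) x (order (n ∘ suc)) | Fin.splitAt-↑ʳ (n zero) (order (n ∘ suc)) (ι (n ∘ suc) b y) = ≡.refl
  adj-ι-≢ {suc m} {n} G {suc a} {zero}  a≢b x y
    rewrite Fin.splitAt-↑ʳ (n zero) (order (n ∘ suc)) (ι (n ∘ suc) a x) | Fin.splitAt-↑ˡ (n zero) y (order (n ∘ suc)) = ≡.refl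
  adj-ι-≢ {suc m} {n} G {suc a} {suc b} a≢b x y
    rewrite Fin.splitAt-↑ʳ (n zero) (order (n ∘ suc)) (ι (n ∘ suc) a x) | Fin.splitAt-↑ʳ (n zero) (order (n ∘ suc)) (ι (n ∘ suc) b y)
    = adj-ι-≢ (G ∘ suc) (a≢b ∘ ≡.cong suc) x y

  -- Consecutive vertices of a path have adjacent images, and no edge of the union joins different
  -- components.
  stays-in-component : ∀ {m} {n : Fin m → ℕ} (G : ∀ i → Graph (n i)) (f : Fin (order n) → Fin (order n)) →
    (∀ u v → adj (⨆ G) (f u) (f v) ≡ adj (⨆ G) u v) →
    ∀ {a b x₁ x₂ y₁} → Star (Adjacent (G a)) x₁ x₂ → f (ι n a x₁) ≡ ι n b y₁ → ∃[ y₂ ] f (ι n a x₂) ≡ ι n b y₂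
  stays-in-component G f pres ε⋆ fx≡y = _ , fx≡y
  stays-in-component {n = n} G f pres {a} {b} {x₁} {x₂} {y₁} (_◅_ {j = x} x₁~x path) fx₁≡y₁
    with ι-surjective {n = n} (f (ι n a x))
  ... | c , y , y≡fx with b Fin.≟ c
  ...   | yes ≡.refl = stays-in-component G f pres path (≡.sym y≡fx)
  ...   | no  b≢c with () ← ≡.trans (≡.sym (adj-ι-≢ G b≢c y₁ y))
          (≡.trans (≡.cong₂ (adj (⨆ G)) (≡.sym fx₁≡y₁) y≡fx) (≡.trans (pres _ _) (≡.trans (adj-ι G a x₁ x) x₁~x)))

  -- Connectedness of `G a` spreads the one given image over the whole component; connectedness of
  -- `G b` does the same for the inverse of `φ`, which provides the inverse map.
  component-isomorphism : ∀ {m} {n : Fin m → ℕ} (G : ∀ i → Graph (n i)) → (∀ i → Connected (G i)) →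
    ((φ , _) : ⨆ G ≅ ⨆ G) → ∀ {a b x₀ y₀} → Inverse.to φ (ι n a x₀) ≡ ι n b y₀ → G a ≅ G b
  component-isomorphism {n = n} G conn (φ , pres) {a} {b} {x₀} {y₀} φx₀≡y₀ = mk↔ₛ′ to from to-from from-to , pres′
    where
    pres⁻¹ : ∀ u v → adj (⨆ G) (Inverse.from φ u) (Inverse.from φ v) ≡ adj (⨆ G) u v
    pres⁻¹ u v = ≡.trans (≡.sym (pres _ _))
      (≡.cong₂ (adj (⨆ G)) (Inverse.strictlyInverseˡ φ u) (Inverse.strictlyInverseˡ φ v))

    image : ∀ x → ∃[ y ] Inverse.to φ (ι n a x) ≡ ι n b y
    image x = stays-in-component G (Inverse.to φ) pres (proj₂ (conn a) x₀ x) φx₀≡y₀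

    preimage : ∀ y → ∃[ x ] Inverse.from φ (ι n b y) ≡ ι n a x
    preimage y = stays-in-component G (Inverse.from φ) pres⁻¹ (proj₂ (conn b) y₀ y)
      (≡.trans (≡.cong (Inverse.from φ) (≡.sym φx₀≡y₀)) (Inverse.strictlyInverseʳ φ _))

    to : Fin (n a) → Fin (n b)
    to x = proj₁ (image x)

    from : Fin (n b) → Fin (n a)
    from y = proj₁ (preimage y)

    to-from : ∀ y → to (from y) ≡ y
    to-from y = ,-injectiveʳ (ι-injective {n = n} (≡.trans (≡.sym (proj₂ (image (from y))))
      (≡.trans (≡.cong (Inverse.to φ) (≡.sym (proj₂ (preimage y)))) (Inverse.strictlyInverseˡ φ _))))

    from-to : ∀ x → from (to x) ≡ x
    from-to x = ,-injectiveʳ (ι-injective {n = n} (≡.trans (≡.sym (proj₂ (preimage (to x))))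
      (≡.trans (≡.cong (Inverse.from φ) (≡.sym (proj₂ (image x)))) (Inverse.strictlyInverseʳ φ _))))

    pres′ : ∀ x x′ → adj (G b) (to x) (to x′) ≡ adj (G a) x x′
    pres′ x x′ = ≡.trans (≡.sym (adj-ι G b _ _)) (≡.trans (≡.cong₂ (adj (⨆ G)) (≡.sym (proj₂ (image x))) (≡.sym (proj₂ (image x′))))
      (≡.trans (pres _ _) (adj-ι G a x x′)))

  opaque
    -- Only injectivity is verified; finiteness of the vertex set turns it into a bijection, so `π`
    -- may be given merely as an injection.
    combine-isomorphisms : ∀ {m} {n : Fin m → ℕ} (G : ∀ i → Graph (n i)) (π : Fin m → Fin m) → Injective _≡_ _≡_ π →
      (θ : ∀ a → G a ≅ G (π a)) →
      Σ[ φ ∈ ⨆ G ≅ ⨆ G ] (∀ a x → Inverse.to (proj₁ φ) (ι n a x) ≡ ι n (π a) (Inverse.to (proj₁ (θ a)) x))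
    combine-isomorphisms {m} {n} G π π-inj θ = (injective⇒↔ f f-inj , pres) , f-ι
      where
      image : ∃ (Fin ∘ n) → ∃ (Fin ∘ n)
      image (a , x) = π a , Inverse.to (proj₁ (θ a)) x

      ι′ : ∃ (Fin ∘ n) → Fin (order n)
      ι′ (a , x) = ι n a x

      index : Fin (order n) → ∃ (Fin ∘ n)
      index u = let a , x , _ = ι-surjective {n = n} u in a , x

      ι-index : ∀ u → ι′ (index u) ≡ u
      ι-index u = proj₂ (proj₂ (ι-surjective {n = n} u))

      f : Fin (order n) → Fin (order n)
      f u = ι′ (image (index u))

      f-ι : ∀ a x → f (ι n a x) ≡ ι n (π a) (Inverse.to (proj₁ (θ a)) x)
      f-ι a x = ≡.cong (ι′ ∘ image) (ι-injective {n = n} (ι-index (ι n a x)))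

      image-inj : ∀ {p q} → image p ≡ image q → p ≡ q
      image-inj {a , x} {b , y} eq with π-inj (≡.cong proj₁ eq)
      ... | ≡.refl = ≡.cong (a ,_) (≡.trans (≡.sym (Inverse.strictlyInverseʳ (proj₁ (θ a)) x))
        (≡.trans (≡.cong (Inverse.from (proj₁ (θ a))) (,-injectiveʳ eq)) (Inverse.strictlyInverseʳ (proj₁ (θ a)) y)))

      f-inj : Injective _≡_ _≡_ f
      f-inj {u} {v} eq = ≡.trans (≡.sym (ι-index u)) (≡.trans (≡.cong ι′ (image-inj (ι-injective {n = n} eq))) (ι-index v))

      pres-index : ∀ p q → adj (⨆ G) (ι′ (image p)) (ι′ (image q)) ≡ adj (⨆ G) (ι′ p) (ι′ q)
      pres-index (a , x) (b , y) with a Fin.≟ b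
      ... | yes ≡.refl = ≡.trans (adj-ι G (π a) _ _) (≡.trans (proj₂ (θ a) x y) (≡.sym (adj-ι G a x y)))
      ... | no a≢b     = ≡.trans (adj-ι-≢ G (a≢b ∘ π-inj) _ _) (≡.sym (adj-ι-≢ G a≢b x y))

      pres : ∀ u v → adj (⨆ G) (f u) (f v) ≡ adj (⨆ G) u v
      pres u v = ≡.trans (pres-index (index u) (index v)) (≡.cong₂ (adj (⨆ G)) (ι-index u) (ι-index v))

-- Regular connected graphs and intertwining blocks

vertex : ∀ {n} → NonZero n → Fin n
vertex {suc n} _ = zero

module RegularGraphs (ℝ : RealNumbers) where
  open OrderedField ℝ
  open ≤-Reasoning
  open Over ℝ
  open MatrixOver commutativeRing

  size : ℕ → Carrier
  size n = sum {n} (λ _ → 1#)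

  size-positive : ∀ {n} → Fin n → 0# < size n
  size-positive i = 0<-resp-≤ 0<1 (term≤sum (λ _ → 0≤1) i)

  sum-const : ∀ {n} c → sum {n} (λ _ → c) ≈ size n * c
  sum-const {n} c = trans (sum-cong-≋ {n} λ _ → sym (*-identityˡ c)) (sym (*-distribʳ-sum {n} c (λ _ → 1#)))

  size-cancel : ∀ {n} → Fin n → ∀ {x y} → size n * x ≈ size n * y → x ≈ y
  size-cancel {n} i {x} {y} eq = x∙y⁻¹≈ε⇒x≈y x y (*-cancelˡ-0 (0<⇒≉ (size-positive i))
    (trans (solve 3 (λ s x y → s :* (x :- y) := s :* x :- s :* y) refl (size n) x y)
           (trans (+-congʳ eq) (-‿inverseʳ _))))

  module _ {n k : ℕ} {G : Graph n} (regular : Regular k G) where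

    private
      indicator-sum : ∀ {n} (p : Fin n → Bool) → sum (indicator ∘ p) ≈ ℤ⟦ + Subset.∣ tabulate p ∣ ⟧
      indicator-sum {zero}  p = refl
      indicator-sum {suc n} p with p zero
      ... | true  = +-congˡ (indicator-sum (p ∘ suc))
      ... | false = trans (+-identityˡ _) (indicator-sum (p ∘ suc))

    degree-row : ∀ u → rowSum (adjacency G) u ≈ ℤ⟦ + k ⟧
    degree-row u = trans (indicator-sum (adj G u)) (reflexive (≡.cong (λ d → ℤ⟦ + d ⟧) (regular u)))

  -- The minimum principle: a vertex where f is minimal has only neighbours where f is minimal.
  harmonic⇒constant : ∀ {n} (G : Graph n) {κ} → (∀ u → rowSum (adjacency G) u ≈ κ) → Connected G →
    (f : Fin n → Carrier) → (∀ u → sum (λ v → adjacency G (u , v) * f v) ≈ κ * f u) → ∀ u v → f u ≈ f v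
  harmonic⇒constant {n} G {κ} degree (nonZero , paths) f harmonic u v =
    trans (from-least (paths least u) refl) (sym (from-least (paths least v) refl))
    where
    least : Fin n
    least = proj₁ (minimum (vertex nonZero) f)

    m : Carrier
    m = f least

    m≤f : ∀ v → m ≤ f v
    m≤f = proj₂ (minimum (vertex nonZero) f)

    A : Matrix Carrier n
    A = adjacency G

    A-nonNegative : ∀ a → 0# ≤ A a
    A-nonNegative (u , v) with adj G u v
    ... | true  = 0≤1
    ... | false = ≤-refl

    excess : ∀ u → f u ≈ m → sum (λ v → A (u , v) * (f v - m)) ≈ 0#
    excess u fu≈m = begin-equality
      sum (λ v → A (u , v) * (f v - m))
        ≈⟨ sum-cong-≋ (λ v → solve 3 (λ a x y → a :* (x :- y) := a :* x :- a :* y) refl (A (u , v)) (f v) m) ⟩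
      sum (λ v → A (u , v) * f v - A (u , v) * m)
        ≈⟨ sum-distrib-- (λ v → A (u , v) * f v) (λ v → A (u , v) * m) ⟩
      sum (λ v → A (u , v) * f v) - sum (λ v → A (u , v) * m)
        ≈⟨ +-cong (trans (harmonic u) (*-congˡ fu≈m))
                  (-‿cong (trans (sym (*-distribʳ-sum m (λ v → A (u , v)))) (*-congʳ (degree u)))) ⟩
      κ * m - κ * m  ≈⟨ -‿inverseʳ _ ⟩
      0#             ∎

    neighbour : ∀ u v → Adjacent G u v → f u ≈ m → f v ≈ m
    neighbour u v u~v fu≈m = x∙y⁻¹≈ε⇒x≈y _ _ (begin-equality
      f v - m                  ≈⟨ *-identityˡ _ ⟨
      1# * (f v - m)           ≡⟨ ≡.cong (λ b → indicator b * (f v - m)) u~v ⟨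
      A (u , v) * (f v - m)
        ≈⟨ sum≈0⇒≈0 (λ v → *-nonNegative (A-nonNegative (u , v)) (x≤y⇒0≤y-x (m≤f v))) (excess u fu≈m) v ⟩
      0#                       ∎)

    from-least : ∀ {u v} → Star (Adjacent G) u v → f u ≈ m → f v ≈ m
    from-least ε⋆            fu≈m = fu≈m
    from-least (u~w ◅ path) fu≈m = from-least path (neighbour _ _ u~w fu≈m)

  -- The equation `A_G B = B A_H` for a rectangular `B`: the form that commutation with the
  -- adjacency matrix takes on a block between two components.
  Intertwines : ∀ {p q} → Graph p → Graph q → (Fin p → Fin q → Carrier) → Set
  Intertwines G H B = ∀ x y →
    sum (λ x′ → adjacency G (x , x′) * B x′ y) ≈ sum (λ y′ → B x y′ * adjacency H (y′ , y))

  intertwines-transpose : ∀ {p q} (G : Graph p) (H : Graph q) {B} → Intertwines G H B → Intertwines H G (λ y x → B x y)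
  intertwines-transpose G H {B} intertwines y x = begin-equality
    sum (λ y′ → adjacency H (y , y′) * B x y′)
      ≈⟨ sum-cong-≋ (λ y′ → trans (*-congʳ (reflexive (≡.cong indicator (adj-sym H y y′)))) (*-comm _ _)) ⟩
    sum (λ y′ → B x y′ * adjacency H (y′ , y))  ≈⟨ intertwines x y ⟨
    sum (λ x′ → adjacency G (x , x′) * B x′ y)
      ≈⟨ sum-cong-≋ (λ x′ → trans (*-comm _ _) (*-congˡ (reflexive (≡.cong indicator (adj-sym G x x′))))) ⟩
    sum (λ x′ → B x′ y * adjacency G (x′ , x))  ∎

  -- Apply `A_G B = B A_H` to the all-ones vector `1`: regularity of `H` gives
  -- `A_G (B 1) = k (B 1)`, and the entries of `B 1` are the row sums.
  intertwiner-rowSums : ∀ {p q k} {G : Graph p} {H : Graph q} → Regular k G → Connected G → Regular k H →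
    ∀ {B} → Intertwines G H B → ∀ x x′ → sum (B x) ≈ sum (B x′)
  intertwiner-rowSums {k = k} {G} {H} regularG connected regularH {B} intertwines =
    harmonic⇒constant G (degree-row {G = G} regularG) connected (λ x → sum (B x)) λ x → begin-equality
      sum (λ x′ → adjacency G (x , x′) * sum (B x′))
        ≈⟨ sum-cong-≋ (λ x′ → *-distribˡ-sum _ (B x′)) ⟩
      sum (λ x′ → sum λ y → adjacency G (x , x′) * B x′ y)
        ≈⟨ ∑-comm (λ x′ y → adjacency G (x , x′) * B x′ y) ⟩
      sum (λ y → sum λ x′ → adjacency G (x , x′) * B x′ y)
        ≈⟨ sum-cong-≋ (λ y → intertwines x y) ⟩
      sum (λ y → sum λ y′ → B x y′ * adjacency H (y′ , y))
        ≈⟨ ∑-comm (λ y y′ → B x y′ * adjacency H (y′ , y)) ⟩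
      sum (λ y′ → sum λ y → B x y′ * adjacency H (y′ , y))
        ≈⟨ sum-cong-≋ (λ y′ → trans (sym (*-distribˡ-sum (B x y′) (λ y → adjacency H (y′ , y))))
                                    (trans (*-congˡ (degree-row {G = H} regularH y′)) (*-comm _ _))) ⟩
      sum (λ y′ → ℤ⟦ + k ⟧ * B x y′)
        ≈⟨ *-distribˡ-sum ℤ⟦ + k ⟧ (B x) ⟨
      ℤ⟦ + k ⟧ * sum (B x) ∎

  -- Divided by `s`, the matrix lies in the polytope and by compactness is a convex combination of
  -- automorphisms; any one of nonzero weight lies inside its support.
  compact⇒automorphismInSupport : ∀ {n} (G : Graph n) → Compact G → ∀ {s P} → 0# < s → P ∈ Decomposition.Cone ℝ G s →
    Σ[ φ ∈ G ≅ G ] (∀ i → ¬ (P (i , Inverse.to (proj₁ φ) i) ≈ 0#))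
  compact⇒automorphismInSupport {n} G (P⊆IP , _) {s} {P} 0<s (commutes , columns , rows , 0≤P) =
    φ , λ x Px≈0 → 0≉1 (begin-equality
      0#                                        ≈⟨ q⊆P (x , Inverse.to (proj₁ φ) x) (trans (*-congʳ Px≈0) (zeroˡ s⁻¹)) ⟨
      q (x , Inverse.to (proj₁ φ) x)            ≈⟨ q≈ (x , Inverse.to (proj₁ φ) x) ⟩
      δ (Inverse.to (proj₁ φ) x) (Inverse.to (proj₁ φ) x) ≈⟨ δ-refl (Inverse.to (proj₁ φ) x) ⟩
      1#                                        ∎)
    where
    A : Matrix Carrier n
    A = adjacency G

    s⁻¹∃ : ∃[ y ] (0# < y × s * y ≈ 1#)
    s⁻¹∃ = positive-inverse 0<s

    s⁻¹ : Carrier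
    s⁻¹ = proj₁ s⁻¹∃

    P′ : Matrix Carrier n
    P′ a = P a * s⁻¹

    normalised : ∀ {m} (f : Fin m → Carrier) → sum f ≈ s → sum (λ i → f i * s⁻¹) ≈ 1#
    normalised f ∑f≈s = trans (sym (*-distribʳ-sum s⁻¹ f)) (trans (*-congʳ ∑f≈s) (proj₂ (proj₂ s⁻¹∃)))

    P′∈ : P′ ∈ P-polytope G
    P′∈ = (λ (i , j) → begin-equality
          sum (λ k → P (i , k) * s⁻¹ * A (k , j))
            ≈⟨ sum-cong-≋ (λ k → solve 3 (λ p i a → p :* i :* a := p :* a :* i) refl (P (i , k)) s⁻¹ (A (k , j))) ⟩
          sum (λ k → P (i , k) * A (k , j) * s⁻¹)  ≈⟨ *-distribʳ-sum s⁻¹ (λ k → P (i , k) * A (k , j)) ⟨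
          (P *ᴹ A) (i , j) * s⁻¹                   ≈⟨ *-congʳ (commutes (i , j)) ⟩
          (A *ᴹ P) (i , j) * s⁻¹                   ≈⟨ *-distribʳ-sum s⁻¹ (λ k → A (i , k) * P (k , j)) ⟩
          sum (λ k → A (i , k) * P (k , j) * s⁻¹)  ≈⟨ sum-cong-≋ (λ k → *-assoc (A (i , k)) (P (k , j)) s⁻¹) ⟩
          sum (λ k → A (i , k) * (P (k , j) * s⁻¹)) ∎)
      , (λ j → normalised (λ i → P (i , j)) (columns j))
      , (λ i → normalised (λ j → P (i , j)) (rows i))
      , (λ a → *-nonNegative (0≤P a) (proj₁ (proj₁ (proj₂ s⁻¹∃))))

    generator-in-support : ∃[ q ] (q ∈ P-polytope G ∩ Integral × (∀ a → P′ a ≈ 0# → q a ≈ 0#))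
    generator-in-support = ThetaBody.support-of-generator ℝ (Fin n × Fin n) {P-polytope G ∩ Integral}
      (λ p∈ → proj₂ (proj₂ (proj₂ (proj₁ p∈)))) {P′} (P⊆IP {P′} P′∈)

    q : Matrix Carrier n
    q = proj₁ generator-in-support

    q⊆P : ∀ a → P′ a ≈ 0# → q a ≈ 0#
    q⊆P = proj₂ (proj₂ generator-in-support)

    q-automorphism : ∃[ φ ] (∀ a → q a ≈ GraphPolytopes.automorphismMatrix ℝ G φ a)
    q-automorphism = GraphPolytopes.integral⇒automorphism ℝ G {q} (proj₁ (proj₂ generator-in-support))

    φ : G ≅ G
    φ = proj₁ q-automorphism

    q≈ : ∀ a → q a ≈ GraphPolytopes.automorphismMatrix ℝ G φ a
    q≈ = proj₂ q-automorphism

-- Disjoint unions of regular connected compact graphs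

module RegularUnions (ℝ : RealNumbers) where
  open OrderedField ℝ
  open ≤-Reasoning
  open Over ℝ
  open MatrixOver commutativeRing
  open RegularGraphs ℝ
  open DisjointUnion
  open Matching ℝ

  sum-↑ : ∀ m {n} (f : Fin (m ℕ.+ n) → Carrier) → sum f ≈ sum (λ i → f (i ↑ˡ n)) + sum (λ j → f (m ↑ʳ j))
  sum-↑ zero    f = sym (+-identityˡ _)
  sum-↑ (suc m) f = trans (+-congˡ (sum-↑ m (f ∘ suc))) (sym (+-assoc _ _ _))

  sum-ι : ∀ {m} (n : Fin m → ℕ) (f : Fin (order n) → Carrier) → sum f ≈ sum (λ a → sum (λ x → f (ι n a x)))
  sum-ι {zero}  n f = refl
  sum-ι {suc m} n f = trans (sum-↑ (n zero) f) (+-congˡ (sum-ι (n ∘ suc) (λ j → f (n zero ↑ʳ j))))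

  sum-↔ : ∀ {p q} (φ : Fin p ↔ Fin q) (f : Fin q → Carrier) → sum (λ x → f (Inverse.to φ x)) ≈ sum f
  sum-↔ φ f = sym (sum-permute f φ)

  module _ {m : ℕ} {n : Fin m → ℕ} (G : ∀ i → Graph (n i)) where

    private
      A : Matrix Carrier (order n)
      A = adjacency (⨆ G)

      Aᵢ : ∀ i → Matrix Carrier (n i)
      Aᵢ i = adjacency (G i)

      A-ι : ∀ a x y → A (ι n a x , ι n a y) ≈ Aᵢ a (x , y)
      A-ι a x y = reflexive (≡.cong indicator (adj-ι G a x y))

      A-ι-≢ : ∀ {a b} → a ≢ b → ∀ x y → A (ι n a x , ι n b y) ≈ 0#
      A-ι-≢ a≢b x y = reflexive (≡.cong indicator (adj-ι-≢ G a≢b x y))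

    sum-neighboursˡ : ∀ a x (f : Fin (order n) → Carrier) →
      sum (λ u → A (ι n a x , u) * f u) ≈ sum (λ y → Aᵢ a (x , y) * f (ι n a y))
    sum-neighboursˡ a x f = begin-equality
      sum (λ u → A (ι n a x , u) * f u)
        ≈⟨ sum-ι n (λ u → A (ι n a x , u) * f u) ⟩
      sum (λ b → sum λ y → A (ι n a x , ι n b y) * f (ι n b y))
        ≈⟨ sum-single (λ b → sum λ y → A (ι n a x , ι n b y) * f (ι n b y)) a
             (λ b a≢b → sum-zero λ y → trans (*-congʳ (A-ι-≢ a≢b x y)) (zeroˡ (f (ι n b y)))) ⟩
      sum (λ y → A (ι n a x , ι n a y) * f (ι n a y))
        ≈⟨ sum-cong-≋ (λ y → *-congʳ (A-ι a x y)) ⟩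
      sum (λ y → Aᵢ a (x , y) * f (ι n a y)) ∎

    sum-neighboursʳ : ∀ a x (f : Fin (order n) → Carrier) →
      sum (λ u → f u * A (u , ι n a x)) ≈ sum (λ y → f (ι n a y) * Aᵢ a (y , x))
    sum-neighboursʳ a x f = begin-equality
      sum (λ u → f u * A (u , ι n a x))
        ≈⟨ sum-cong-≋ (λ u → trans (*-comm _ _) (*-congʳ (reflexive (≡.cong indicator (adj-sym (⨆ G) u (ι n a x)))))) ⟩
      sum (λ u → A (ι n a x , u) * f u)
        ≈⟨ sum-neighboursˡ a x f ⟩
      sum (λ y → Aᵢ a (x , y) * f (ι n a y))
        ≈⟨ sum-cong-≋ (λ y → trans (*-congʳ (reflexive (≡.cong indicator (adj-sym (G a) x y)))) (*-comm _ _)) ⟩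
      sum (λ y → f (ι n a y) * Aᵢ a (y , x)) ∎

    block : Matrix Carrier (order n) → ∀ a b → Fin (n a) → Fin (n b) → Carrier
    block P a b x y = P (ι n a x , ι n b y)

    block-intertwines : ∀ {P} → (∀ c → (P *ᴹ A) c ≈ (A *ᴹ P) c) → ∀ a b → Intertwines (G a) (G b) (block P a b)
    block-intertwines {P} commutes a b x y = begin-equality
      sum (λ x′ → Aᵢ a (x , x′) * P (ι n a x′ , ι n b y))   ≈⟨ sum-neighboursˡ a x (λ u → P (u , ι n b y)) ⟨
      (A *ᴹ P) (ι n a x , ι n b y)                          ≈⟨ commutes (ι n a x , ι n b y) ⟨
      (P *ᴹ A) (ι n a x , ι n b y)                          ≈⟨ sum-neighboursʳ b y (λ u → P (ι n a x , u)) ⟩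
      sum (λ y′ → P (ι n a x , ι n b y′) * Aᵢ b (y′ , y))   ∎

  module _ {k m : ℕ} {n : Fin m → ℕ} (G : ∀ i → Graph (n i))
    (regular : ∀ i → Regular k (G i)) (connected : ∀ i → Connected (G i)) where

    open GraphPolytopes ℝ (⨆ G)
    open Decomposition ℝ (⨆ G)
    open ThetaBody ℝ (Fin (order n) × Fin (order n)) using (conv-mono; conv-support)

    base : ∀ a → Fin (n a)
    base a = vertex (proj₁ (connected a))

    blockSum : Matrix Carrier (order n) → Fin m → Fin m → Carrier
    blockSum P a b = sum (block G P a b (base a))

    -- Relabelling the columns along the isomorphism turns a rectangular block into a square matrix
    -- on `G a` that commutes with its adjacency matrix, so that compactness of `G a` can be applied
    -- to it.
    twistedBlock : Matrix Carrier (order n) → ∀ {a b} → G a ≅ G b → Matrix Carrier (n a)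
    twistedBlock P {a} {b} (θ , _) (x , y) = block G P a b x (Inverse.to θ y)

    -- Every vertex has exactly one pair of coordinates, so quantifying over all of them is the same
    -- as choosing them, and the condition applies directly at `ι n a x`.
    IsomorphicComponents : Fin (order n) × Fin (order n) → Set
    IsomorphicComponents (u , v) = ∀ {a x b y} → ι n a x ≡ u → ι n b y ≡ v → G a ≅ G b

    automorphism⇒isomorphicComponents : ∀ {p} → AutomorphismMatrix p → SupportAllowed IsomorphicComponents p
    automorphism⇒isomorphicComponents (φ , p≈) (u , v) puv≉0 {a} {x} {b} {y} ≡.refl ≡.refl
      with Inverse.to (proj₁ φ) (ι n a x) Fin.≟ ι n b y
    ... | yes φx≡y = component-isomorphism G connected φ φx≡y
    ... | no  φx≢y = contradiction (trans (p≈ _) (δ-≢ φx≢y)) puv≉0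

    module _ {s P} (P∈ : P ∈ Cone s) (allowed : SupportAllowed IsomorphicComponents P) where

      private
        B : ∀ a b → Fin (n a) → Fin (n b) → Carrier
        B = block G P

        0≤B : ∀ a b x y → 0# ≤ B a b x y
        0≤B a b x y = proj₂ (proj₂ (proj₂ P∈)) (ι n a x , ι n b y)

        B-intertwines : ∀ a b → Intertwines (G a) (G b) (B a b)
        B-intertwines = block-intertwines G {P} (proj₁ P∈)

        R : Fin m → Fin m → Carrier
        R = blockSum P

        C : Fin m → Fin m → Carrier
        C a b = sum (λ x → B a b x (base b))

      block-rowSum : ∀ a b x → sum (B a b x) ≈ R a b
      block-rowSum a b x =
        intertwiner-rowSums {G = G a} {H = G b} (regular a) (connected a) (regular b) (B-intertwines a b) x (base a)

      block-columnSum′ : ∀ a b y → sum (λ x → B a b x y) ≈ C a b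
      block-columnSum′ a b y =
        intertwiner-rowSums {G = G b} {H = G a} (regular b) (connected b) (regular a)
          (intertwines-transpose (G a) (G b) (B-intertwines a b)) y (base b)

      R≈0⇒B≈0 : ∀ a b → R a b ≈ 0# → ∀ x y → B a b x y ≈ 0#
      R≈0⇒B≈0 a b R≈0 x = sum≈0⇒≈0 {f = B a b x} (0≤B a b x) (trans (block-rowSum a b x) R≈0)

      R≉0⇒≅ : ∀ a b → ¬ (R a b ≈ 0#) → G a ≅ G b
      R≉0⇒≅ a b R≉0 with y , B≉0 ← sum≉0⇒∃≉0 {f = B a b (base a)} R≉0 =
        allowed (ι n a (base a) , ι n b y) B≉0 ≡.refl ≡.refl

      -- Counting the total of the block by rows and by columns gives
      -- `size (n a) * R a b ≈ size (n b) * C a b`. A nonzero block joins isomorphic components, so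
      -- the sizes cancel; a zero block has both sums zero.
      R≈C : ∀ a b → R a b ≈ C a b
      R≈C a b with R a b ≟ 0#
      ... | yes R≈0 = trans R≈0 (sym (sum-zero λ x → R≈0⇒B≈0 a b R≈0 x (base b)))
      ... | no  R≉0 = size-cancel (base a) (begin-equality
        size (n a) * R a b                     ≈⟨ sum-const {n a} (R a b) ⟨
        sum {n a} (λ _ → R a b)                ≈⟨ sum-cong-≋ (block-rowSum a b) ⟨
        sum (λ x → sum (B a b x))              ≈⟨ ∑-comm (B a b) ⟩
        sum (λ y → sum λ x → B a b x y)        ≈⟨ sum-cong-≋ (block-columnSum′ a b) ⟩
        sum {n b} (λ _ → C a b)                ≈⟨ sum-const {n b} (C a b) ⟩
        size (n b) * C a b                     ≡⟨ ≡.cong (λ k → size k * C a b) (↔⇒≡ (proj₁ (R≉0⇒≅ a b R≉0))) ⟨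
        size (n a) * C a b                     ∎)

      block-columnSum : ∀ a b y → sum (λ x → B a b x y) ≈ R a b
      block-columnSum a b y = trans (block-columnSum′ a b y) (sym (R≈C a b))

      0≤R : ∀ a b → 0# ≤ R a b
      0≤R a b = sum-nonNegative (0≤B a b (base a))

      R-rows : ∀ a → sum (R a) ≈ s
      R-rows a = trans (sym (sum-ι n (λ v → P (ι n a (base a) , v)))) (proj₁ (proj₂ (proj₂ P∈)) (ι n a (base a)))

      R-columns : ∀ b → sum (λ a → R a b) ≈ s
      R-columns b = trans (sum-cong-≋ λ a → R≈C a b)
        (trans (sym (sum-ι n (λ u → P (u , ι n b (base b))))) (proj₁ (proj₂ P∈) (ι n b (base b))))

      twisted-block∈Cone : ∀ {a b} (θ : G a ≅ G b) →
        twistedBlock P θ ∈ Decomposition.Cone ℝ (G a) (R a b)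
      twisted-block∈Cone {a} {b} (θ , pres) =
          (λ (x , y) → begin-equality
            sum (λ z → B a b x (to z) * Aᵢ a (z , y))
              ≈⟨ sum-cong-≋ (λ z → *-congˡ (reflexive (≡.cong indicator (≡.sym (pres z y))))) ⟩
            sum (λ z → B a b x (to z) * Aᵢ b (to z , to y))
              ≈⟨ sum-↔ θ (λ z → B a b x z * Aᵢ b (z , to y)) ⟩
            sum (λ z → B a b x z * Aᵢ b (z , to y))
              ≈⟨ B-intertwines a b x (to y) ⟨
            sum (λ z → Aᵢ a (x , z) * B a b z (to y)) ∎)
        , (λ y → block-columnSum a b (to y))
        , (λ x → trans (sum-↔ θ (B a b x)) (block-rowSum a b x))
        , (λ (x , y) → 0≤B a b x (to y))
        where
        to : Fin (n a) → Fin (n b)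
        to = Inverse.to θ

        Aᵢ : ∀ i → Matrix Carrier (n i)
        Aᵢ i = adjacency (G i)

    -- The block sums of P form a multiple of a doubly stochastic matrix, whose support contains a permutation π of
    -- the components; compactness of G a then gives an isomorphism G a ≅ G (π a) in the support of the block (a , π a).
    union-automorphismInSupport : (∀ i → Compact (G i)) → AutomorphismInSupport IsomorphicComponents
    union-automorphismInSupport compact {s} {P} 0<s P∈ allowed =
      through (support-selection (blockSum P) 0<s (0≤R P∈ allowed) (R-rows P∈ allowed)
                 (λ b → ≤-reflexive (R-columns P∈ allowed b)))
      where
      through : ∃[ π ] SelectsSupport (blockSum P) π → Σ[ φ ∈ ⨆ G ≅ ⨆ G ] (∀ u → ¬ (P (u , Inverse.to (proj₁ φ) u) ≈ 0#))
      through (π , π-inj , Rπ≉0) = Φ , support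
        where
        θ : ∀ a → G a ≅ G (π a)
        θ a = R≉0⇒≅ P∈ allowed a (π a) (Rπ≉0 a)

        ψ : ∀ a → Σ[ ψ ∈ G a ≅ G a ] (∀ x → ¬ (twistedBlock P (θ a) (x , Inverse.to (proj₁ ψ) x) ≈ 0#))
        ψ a = compact⇒automorphismInSupport (G a) (compact a) {blockSum P a (π a)} {twistedBlock P (θ a)}
          (nonNegative∧≉0⇒0< (0≤R P∈ allowed a (π a)) (Rπ≉0 a)) (twisted-block∈Cone P∈ allowed (θ a))

        θψ : ∀ a → G a ≅ G (π a)
        θψ a = ≅-trans {G = G a} {G a} {G (π a)} (proj₁ (ψ a)) (θ a)

        combined : Σ[ φ ∈ ⨆ G ≅ ⨆ G ] (∀ a x → Inverse.to (proj₁ φ) (ι n a x) ≡ ι n (π a) (Inverse.to (proj₁ (θψ a)) x))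
        combined = combine-isomorphisms G π π-inj θψ

        Φ : ⨆ G ≅ ⨆ G
        Φ = proj₁ combined

        support-ι : ∀ {u} → (∃[ a ] ∃[ x ] ι n a x ≡ u) → ¬ (P (u , Inverse.to (proj₁ Φ) u) ≈ 0#)
        support-ι (a , x , ≡.refl) Pu≈0 =
          proj₂ (ψ a) x (trans (reflexive (≡.cong (λ v → P (ι n a x , v)) (≡.sym (proj₂ combined a x)))) Pu≈0)

        support : ∀ u → ¬ (P (u , Inverse.to (proj₁ Φ) u) ≈ 0#)
        support u = support-ι (ι-surjective {n = n} u)

    union-exact : (∀ i → Compact (G i)) → Exact (⨆ G)
    union-exact compact = TH⊆conv-automorphisms⇒exact λ {x} x∈TH →
      supported⇒conv IsomorphicComponents (union-automorphismInSupport compact) {x} (TH⊆polytope {x} x∈TH)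
        λ a xa≉0 → let p , p∈ , pa≉0 = TH-support {x} x∈TH xa≉0 in automorphism⇒isomorphicComponents {p} p∈ a pa≉0

    -- When all components are isomorphic the support condition holds for every matrix, so the
    -- decomposition covers the whole polytope.
    isomorphic⇒polytope⊆IP : (∀ i → Compact (G i)) → (∀ i j → G i ≅ G j) → P-polytope (⨆ G) ⊆ IP-polytope (⨆ G)
    isomorphic⇒polytope⊆IP compact iso {P} P∈ =
      conv-mono (λ {p} p∈ → automorphism⇒polytope {p} p∈ , automorphism⇒integral {p} p∈) {P}
        (supported⇒conv IsomorphicComponents (union-automorphismInSupport compact) {P} P∈ λ _ _ {a} {_} {b} _ _ → iso a b)

    -- The common degree is what makes the uniform matrix commute: all entries of both products
    -- equal `k` times `N⁻¹`. Its entry at the base vertices of `i` and `j` is positive, so some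
    -- automorphism maps one base to the other.
    union-compact⇒isomorphic : Compact (⨆ G) → ∀ i j → G i ≅ G j
    union-compact⇒isomorphic (P⊆IP , _) i j =
      from-support (conv-support (P⊆IP {uniform} uniform∈) {ι n i (base i) , ι n j (base j)} (0<⇒≉ 0<N⁻¹))
      where
      N⁻¹∃ : ∃[ y ] (0# < y × size (order n) * y ≈ 1#)
      N⁻¹∃ = positive-inverse (size-positive (ι n i (base i)))

      N⁻¹ : Carrier
      N⁻¹ = proj₁ N⁻¹∃

      0<N⁻¹ : 0# < N⁻¹
      0<N⁻¹ = proj₁ (proj₂ N⁻¹∃)

      uniform : Matrix Carrier (order n)
      uniform _ = N⁻¹

      union-row : ∀ u → sum (λ v → adjacency (⨆ G) (u , v) * N⁻¹) ≈ ℤ⟦ + k ⟧ * N⁻¹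
      union-row u with a , x , ≡.refl ← ι-surjective {n = n} u =
        trans (sum-neighboursˡ G a x (λ _ → N⁻¹))
          (trans (sym (*-distribʳ-sum N⁻¹ (λ y → adjacency (G a) (x , y)))) (*-congʳ (degree-row {G = G a} (regular a) x)))

      union-column : ∀ v → sum (λ u → N⁻¹ * adjacency (⨆ G) (u , v)) ≈ ℤ⟦ + k ⟧ * N⁻¹
      union-column v = trans
        (sum-cong-≋ λ u → trans (*-comm _ _) (*-congʳ (reflexive (≡.cong indicator (adj-sym (⨆ G) u v))))) (union-row v)

      uniform∈ : uniform ∈ P-polytope (⨆ G)
      uniform∈ = (λ (u , v) → trans (union-column v) (sym (union-row u)))
        , (λ _ → total-weight) , (λ _ → total-weight) , (λ _ → proj₁ 0<N⁻¹)
        where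
        total-weight : sum {order n} (λ _ → N⁻¹) ≈ 1#
        total-weight = trans (sum-const {order n} N⁻¹) (proj₂ (proj₂ N⁻¹∃))

      from-support : ∃[ p ] (p ∈ P-polytope (⨆ G) ∩ Integral × ¬ (p (ι n i (base i) , ι n j (base j)) ≈ 0#)) → G i ≅ G j
      from-support (p , p∈ , p≉0) =
        automorphism⇒isomorphicComponents {p} (integral⇒automorphism {p} p∈) _ p≉0 ≡.refl ≡.refl

-- Constructions that preserve compactness

complement : ∀ {n} → Graph n → Graph n
complement {n} G = record
  { adj     = λ u v → if does (u Fin.≟ v) then false else not (adj G u v)
  ; adj-sym = sym′
  ; no-loop = λ u → ≡.cong (if_then false else not (adj G u u)) (dec-true (u Fin.≟ u) ≡.refl)
  }
  where
  sym′ : ∀ u v → (if does (u Fin.≟ v) then false else not (adj G u v)) ≡ (if does (v Fin.≟ u) then false else not (adj G v u))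
  sym′ u v with u Fin.≟ v | v Fin.≟ u
  ... | yes _   | yes _   = ≡.refl
  ... | yes u≡v | no v≢u  = contradiction (≡.sym u≡v) v≢u
  ... | no u≢v  | yes v≡u = contradiction (≡.sym v≡u) u≢v
  ... | no _    | no _    = ≡.cong not (adj-sym G u v)

module CompactGraphs (ℝ : RealNumbers) where
  open OrderedField ℝ
  open ≤-Reasoning
  open Over ℝ
  open MatrixOver commutativeRing
  open RegularUnions ℝ

  IP⊆polytope : ∀ {n} (G : Graph n) → IP-polytope G ⊆ P-polytope G
  IP⊆polytope {n} G {P} (r , w , p , 0≤w , ∑w≈1 , p∈ , P≈) = commutes
    , (λ j → stochastic (λ i → P (i , j)) (λ l i → p l (i , j)) (λ i → P≈ (i , j)) (λ l → proj₁ (proj₂ (proj₁ (p∈ l))) j))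
    , (λ i → stochastic (λ j → P (i , j)) (λ l j → p l (i , j)) (λ j → P≈ (i , j)) (λ l → proj₁ (proj₂ (proj₂ (proj₁ (p∈ l)))) i))
    , (λ a → ≤-trans (sum-nonNegative λ l → *-nonNegative (0≤w l) (proj₂ (proj₂ (proj₂ (proj₁ (p∈ l)))) a))
                     (≤-reflexive (sym (P≈ a))))
    where
    A : Matrix Carrier n
    A = adjacency G

    stochastic : (f : Fin n → Carrier) (g : Fin r → Fin n → Carrier) → (∀ i → f i ≈ sum (λ l → w l * g l i)) →
      (∀ l → sum (g l) ≈ 1#) → sum f ≈ 1#
    stochastic f g f≈ ∑g≈1 = begin-equality
      sum f                              ≈⟨ sum-cong-≋ f≈ ⟩
      sum (λ i → sum λ l → w l * g l i)  ≈⟨ ∑-comm (λ i l → w l * g l i) ⟩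
      sum (λ l → sum λ i → w l * g l i)
        ≈⟨ sum-cong-≋ (λ l → trans (sym (*-distribˡ-sum (w l) (g l))) (trans (*-congˡ (∑g≈1 l)) (*-identityʳ (w l)))) ⟩
      sum w                              ≈⟨ ∑w≈1 ⟩
      1#                                 ∎

    P*A : ∀ i j → (P *ᴹ A) (i , j) ≈ sum (λ l → w l * (p l *ᴹ A) (i , j))
    P*A i j = begin-equality
      sum (λ k → P (i , k) * A (k , j))
        ≈⟨ sum-cong-≋ (λ k → trans (*-congʳ (P≈ (i , k))) (*-distribʳ-sum (A (k , j)) (λ l → w l * p l (i , k)))) ⟩
      sum (λ k → sum λ l → w l * p l (i , k) * A (k , j))   ≈⟨ ∑-comm (λ k l → w l * p l (i , k) * A (k , j)) ⟩
      sum (λ l → sum λ k → w l * p l (i , k) * A (k , j))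
        ≈⟨ sum-cong-≋ (λ l → trans (sum-cong-≋ λ k → *-assoc (w l) (p l (i , k)) (A (k , j)))
                                   (sym (*-distribˡ-sum (w l) (λ k → p l (i , k) * A (k , j))))) ⟩
      sum (λ l → w l * (p l *ᴹ A) (i , j))                  ∎

    A*P : ∀ i j → (A *ᴹ P) (i , j) ≈ sum (λ l → w l * (A *ᴹ p l) (i , j))
    A*P i j = begin-equality
      sum (λ k → A (i , k) * P (k , j))
        ≈⟨ sum-cong-≋ (λ k → trans (*-congˡ (P≈ (k , j))) (*-distribˡ-sum (A (i , k)) (λ l → w l * p l (k , j)))) ⟩
      sum (λ k → sum λ l → A (i , k) * (w l * p l (k , j)))   ≈⟨ ∑-comm (λ k l → A (i , k) * (w l * p l (k , j))) ⟩
      sum (λ l → sum λ k → A (i , k) * (w l * p l (k , j)))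
        ≈⟨ sum-cong-≋ (λ l → trans
             (sum-cong-≋ λ k → solve 3 (λ a w p → a :* (w :* p) := w :* (a :* p)) refl (A (i , k)) (w l) (p l (k , j)))
             (sym (*-distribˡ-sum (w l) (λ k → A (i , k) * p l (k , j))))) ⟩
      sum (λ l → w l * (A *ᴹ p l) (i , j))                    ∎

    commutes : ∀ a → (P *ᴹ A) a ≈ (A *ᴹ P) a
    commutes (i , j) = trans (P*A i j)
      (trans (sum-cong-≋ λ l → *-congˡ (proj₁ (proj₁ (p∈ l)) (i , j))) (sym (A*P i j)))

  -- P J = J = J P and P I = P = I P, where J = A + A′ + I is the all-ones matrix.
  complementary-polytope : ∀ {n} (G H : Graph n) →
    (∀ u v → adjacency G (u , v) + adjacency H (u , v) + δ u v ≈ 1#) → P-polytope G ⊆ P-polytope H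
  complementary-polytope {n} G H G+H+I≈J {P} (commutes , columns , rows , 0≤P) = commutes′ , columns , rows , 0≤P
    where
    A A′ : Matrix Carrier n
    A  = adjacency G
    A′ = adjacency H

    A′≈ : ∀ u v → A′ (u , v) ≈ 1# - A (u , v) - δ u v
    A′≈ u v = trans (solve 3 (λ a b d → b := (a :+ b :+ d) :- a :- d) refl (A (u , v)) (A′ (u , v)) (δ u v))
      (+-congʳ (+-congʳ (G+H+I≈J u v)))

    sum-- : ∀ (f g h : Fin n → Carrier) → sum (λ k → f k - g k - h k) ≈ sum f - sum g - sum h
    sum-- f g h = trans (sum-distrib-- (λ k → f k - g k) h) (+-congʳ (sum-distrib-- f g))

    commutes′ : ∀ a → (P *ᴹ A′) a ≈ (A′ *ᴹ P) a
    commutes′ (i , j) = begin-equality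
      sum (λ k → P (i , k) * A′ (k , j))
        ≈⟨ sum-cong-≋ (λ k → trans (*-congˡ (trans (A′≈ k j) (+-congˡ (-‿cong (δ-comm k j))))) (expandʳ (P (i , k)) (A (k , j)) (δ j k))) ⟩
      sum (λ k → P (i , k) - P (i , k) * A (k , j) - δ j k * P (i , k))
        ≈⟨ sum-- (λ k → P (i , k)) (λ k → P (i , k) * A (k , j)) (λ k → δ j k * P (i , k)) ⟩
      rowSum P i - (P *ᴹ A) (i , j) - sum (λ k → δ j k * P (i , k))
        ≈⟨ +-cong (+-cong (trans (rows i) (sym (columns j))) (-‿cong (commutes (i , j))))
                  (-‿cong (trans (sum-δˡ j (λ k → P (i , k))) (sym (sum-δˡ i (λ k → P (k , j)))))) ⟩
      columnSum P j - (A *ᴹ P) (i , j) - sum (λ k → δ i k * P (k , j))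
        ≈⟨ sum-- (λ k → P (k , j)) (λ k → A (i , k) * P (k , j)) (λ k → δ i k * P (k , j)) ⟨
      sum (λ k → P (k , j) - A (i , k) * P (k , j) - δ i k * P (k , j))
        ≈⟨ sum-cong-≋ (λ k → trans (expandˡ (P (k , j)) (A (i , k)) (δ i k)) (*-congʳ (sym (A′≈ i k)))) ⟩
      sum (λ k → A′ (i , k) * P (k , j)) ∎
      where
      δ-comm : ∀ k j → δ k j ≈ δ j k
      δ-comm k j with k Fin.≟ j
      ... | yes ≡.refl = refl
      ... | no  k≢j    = trans (δ-≢ k≢j) (sym (δ-≢ (k≢j ∘ ≡.sym)))

      expandʳ : ∀ p a d → p * (1# - a - d) ≈ p - p * a - d * p
      expandʳ p a d = trans (solve 4 (λ p a d i → p :* (i :- a :- d) := p :* i :- p :* a :- d :* p) refl p a d 1#)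
        (+-congʳ (+-congʳ (*-identityʳ p)))

      expandˡ : ∀ p a d → p - a * p - d * p ≈ (1# - a - d) * p
      expandˡ p a d = sym (trans (solve 4 (λ p a d i → (i :- a :- d) :* p := p :* i :- a :* p :- d :* p) refl p a d 1#)
        (+-congʳ (+-congʳ (*-identityʳ p))))

  -- A graph and its complement have the same polytope, hence the same integral points and the same
  -- integer hull.
  complement-compact : ∀ {n} (G : Graph n) → Compact G → Compact (complement G)
  complement-compact {n} G (P⊆IP , _) =
      (λ {P} P∈ → ThetaBody.conv-mono ℝ (Fin n × Fin n) {P-polytope G ∩ Integral} {P-polytope (complement G) ∩ Integral}
        (λ {p} (p∈ , p∈ℤ) → G⊆Gᶜ {p} p∈ , p∈ℤ) {P} (P⊆IP {P} (Gᶜ⊆G {P} P∈)))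
    , λ {P} → IP⊆polytope (complement G) {P}
    where
    A+Aᶜ+I≈J : ∀ u v → adjacency G (u , v) + adjacency (complement G) (u , v) + δ u v ≈ 1#
    A+Aᶜ+I≈J u v with u Fin.≟ v
    ... | yes ≡.refl rewrite no-loop G u = trans (+-cong (+-identityˡ 0#) (δ-refl u)) (+-identityˡ 1#)
    ... | no  u≢v with adj G u v
    ...   | true  = trans (+-cong (+-identityʳ 1#) (δ-≢ u≢v)) (+-identityʳ 1#)
    ...   | false = trans (+-cong (+-identityˡ 1#) (δ-≢ u≢v)) (+-identityʳ 1#)

    G⊆Gᶜ : P-polytope G ⊆ P-polytope (complement G)
    G⊆Gᶜ = complementary-polytope G (complement G) A+Aᶜ+I≈J

    Gᶜ⊆G : P-polytope (complement G) ⊆ P-polytope G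
    Gᶜ⊆G = complementary-polytope (complement G) G λ u v → trans (+-congʳ (+-comm _ _)) (A+Aᶜ+I≈J u v)

  -- The sufficient condition for compactness of a union, reused as a source of compact graphs:
  -- copies of one graph are trivially isomorphic.
  copies-compact : ∀ m {n k} (G : Graph n) → Regular k G → Connected G → Compact G → Compact (⨆ {m} (λ _ → G))
  copies-compact m {n} {k} G regular connected compact =
      (λ {P} → isomorphic⇒polytope⊆IP {k} {m} {λ _ → n} (λ _ → G) (λ _ → regular) (λ _ → connected) (λ _ → compact)
        (λ _ _ → ≅-refl {G = G}) {P})
    , λ {P} → IP⊆polytope (⨆ {m} (λ _ → G)) {P}

-- A compact triangle and 4-cycle whose union is not compact

-- All graphs below have diameter at most two, so connectedness reduces to a finite check that is
-- decided by computation.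
two-step-connected : ∀ {n} {G : Graph n} → NonZero n →
  (∀ u v → Adjacent G u v ⊎ ∃[ w ] (Adjacent G u w × Adjacent G w v)) → Connected G
two-step-connected {G = G} nonZero steps = nonZero , λ u v → path (steps u v)
  where
  path : ∀ {u v} → Adjacent G u v ⊎ ∃[ w ] (Adjacent G u w × Adjacent G w v) → Star (Adjacent G) u v
  path (inj₁ u~v)               = u~v ◅ ε⋆
  path (inj₂ (w , u~w , w~v)) = u~w ◅ w~v ◅ ε⋆

two-steps? : ∀ {n} (G : Graph n) → Dec (∀ u v → Adjacent G u v ⊎ ∃[ w ] (Adjacent G u w × Adjacent G w v))
two-steps? G = Fin.all? λ u → Fin.all? λ v →
  (adj G u v Bool.≟ true) ⊎-dec Fin.any? λ w → (adj G u w Bool.≟ true) ×-dec (adj G w v Bool.≟ true)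

regular? : ∀ {n} k (G : Graph n) → Dec (Regular k G)
regular? k G = Fin.all? λ u → Subset.∣ neighbours G u ∣ ℕ.≟ k

K₁ : Graph 1
K₁ = record { adj = λ _ _ → false ; adj-sym = λ _ _ → ≡.refl ; no-loop = λ _ → ≡.refl }

K₂ : Graph 2
K₂ = complement (⨆ {2} λ _ → K₁)

K₂-regular : Regular 1 K₂
K₂-regular = from-yes (regular? 1 K₂)

K₂-connected : Connected K₂
K₂-connected = two-step-connected {G = K₂} _ (from-yes (two-steps? K₂))

C₃ : Graph 3
C₃ = complement (⨆ {3} λ _ → K₁)

-- C₄ = K₂,₂ is the complement of two disjoint edges.
C₄ : Graph 4
C₄ = complement (⨆ {2} λ _ → K₂)

-- The two shortest cycles: both are connected and 2-regular, and their orders already tell them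
-- apart.
cycleLength : Fin 2 → ℕ
cycleLength zero    = 3
cycleLength (suc _) = 4

cycle : ∀ i → Graph (cycleLength i)
cycle zero    = C₃
cycle (suc _) = C₄

cycle-regular : ∀ i → Regular 2 (cycle i)
cycle-regular zero    = from-yes (regular? 2 C₃)
cycle-regular (suc _) = from-yes (regular? 2 C₄)

cycle-connected : ∀ i → Connected (cycle i)
cycle-connected zero    = two-step-connected {G = C₃} _ (from-yes (two-steps? C₃))
cycle-connected (suc _) = two-step-connected {G = C₄} _ (from-yes (two-steps? C₄))

C₃≇C₄ : ¬ (C₃ ≅ C₄)
C₃≇C₄ (φ , _) = contradiction (↔⇒≡ φ) λ ()

module _ (ℝ : RealNumbers) where
  open OrderedField ℝ
  open Over ℝ
  open CompactGraphs ℝ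
  open RegularUnions ℝ

  -- The row condition leaves only the matrix with entry 1, which is integral.
  K₁-compact : Compact K₁
  K₁-compact =
      (λ {P} P∈@(_ , _ , rows , _) → 1 , (λ _ → 1#) , (λ _ → P) , (λ _ → 0≤1) , +-identityʳ 1#
        , (λ _ → P∈ , λ { (zero , zero) → + 1 , trans (sym (+-identityʳ _)) (trans (rows zero) (sym (+-identityʳ 1#))) })
        , λ a → sym (trans (+-identityʳ _) (*-identityˡ (P a))))
    , λ {P} → IP⊆polytope K₁ {P}

  copies-of-K₁-compact : ∀ m → Compact (⨆ {m} λ _ → K₁)
  copies-of-K₁-compact m = copies-compact m {k = 0} K₁ (λ { zero → ≡.refl }) (_ , λ { zero zero → ε⋆ }) K₁-compact

  K₂-compact : Compact K₂
  K₂-compact = complement-compact (⨆ {2} λ _ → K₁) (copies-of-K₁-compact 2)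

  cycle-compact : ∀ i → Compact (cycle i)
  cycle-compact zero    = complement-compact (⨆ {3} λ _ → K₁) (copies-of-K₁-compact 3)
  cycle-compact (suc _) = complement-compact (⨆ {2} λ _ → K₂) (copies-compact 2 K₂ K₂-regular K₂-connected K₂-compact)

  cycles-exact : Exact (⨆ cycle)
  cycles-exact = union-exact {n = cycleLength} cycle cycle-regular cycle-connected cycle-compact

  cycles-not-compact : ¬ Compact (⨆ cycle)
  cycles-not-compact compact = C₃≇C₄
    (union-compact⇒isomorphic {n = cycleLength} cycle cycle-regular cycle-connected compact zero (suc zero))

theorem4p4 : (ℝ : RealNumbers) → let open Over ℝ in
    ((∀ {n} (G : Graph n) → Compact G → Exact G)
    × (∃[ n ] Σ[ G ∈ Graph n ] (Exact G × ¬ Compact G)))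
    × ((k m : ℕ) (n : Fin m → ℕ) (G : (i : Fin m) → Graph (n i)) →
    (∀ i → Regular k (G i)) → (∀ i → Connected (G i)) → (∀ i → Compact (G i)) →
    Exact (⨆ G) × (Compact (⨆ G) ⇔ (∀ i j → G i ≅ G j)))
    × (∃[ k ] ∃[ m ] Σ[ n ∈ (Fin m → ℕ) ] Σ[ G ∈ ((i : Fin m) → Graph (n i)) ]
    ( (∀ i → Regular k (G i)) × (∀ i → Connected (G i)) × (∀ i → Compact (G i))
    × ¬ Compact (⨆ G)))
theorem4p4 ℝ =
    ((λ G → GraphPolytopes.compact⇒exact ℝ G) , order cycleLength , ⨆ cycle , cycles-exact ℝ , cycles-not-compact ℝ)
  , (λ k m n G regular connected compact →
        union-exact G regular connected compact
      , mk⇔ (union-compact⇒isomorphic G regular connected)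
            (λ iso → (λ {P} → isomorphic⇒polytope⊆IP G regular connected compact iso {P}) , λ {P} → IP⊆polytope (⨆ G) {P}))
  , 2 , 2 , cycleLength , cycle , cycle-regular , cycle-connected , cycle-compact ℝ , cycles-not-compact ℝ
  where
  open RegularUnions ℝ
  open CompactGraphs ℝ
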